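{- For all integers $n\ge0$, the sequences $(w(m,n))_{m\in\mathbb{Z}}$ and $(z(m,n))_{m\in\mathbb{Z}}$ are both symmetric and unimodal. In particular, for all integers $m,n\ge0$: $w(m,n)>w(m+2,n)$ provided $w(m,n)\ne0$, and $z(m,n)>z(m+2,n)$ provided $z(m,n)\ne0$.
   Context: $(a;q)_n=\prod_{0\le j<n}(1-aq^j)$, $(a,b;q)_n=(a;q)_n(b;q)_n$; in particular $(q;-q)_{2n+1}=\prod_{0\le j\le 2n}(1-q(-q)^j)$. Define $w(m,n)$ and $z(m,n)$ by $$\sum_{n\ge0}\sum_{m\in\mathbb{Z}}w(m,n)x^mq^n=\sum_{n\ge0}\frac{(-xq,-x^{ -1}q;q^2)_nq^{2n}}{(q;-q)_{2n+1}},\qquad \sum_{n\ge0}\sum_{m\in\mathbb{Z}}z(m,n)x^mq^n=\sum_{n\ge0}\frac{(-xq,-x^{ -1}q;q)_nq^n}{(q;q)_{2n+1}}.$$ A two-sided sequence with finitely many nonzero terms is symmetric if its $m$-th and $(-m)$-th terms agree, and unimodal if, restricted to the smallest interval of indices containing all its nonzero terms, it first weakly increases and then weakly decreases. -}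

module Defs where

open import Data.Nat as ℕ using (ℕ; zero; suc)
open import Data.Integer as ℤ using (ℤ; +_; -[1+_]; -_; ∣_∣)
open import Data.Integer.Properties using (_≟_)
open import Data.List using (List; []; _∷_; _++_; concatMap; map; foldr)
open import Data.Product using (_×_; _,_; ∃-syntax)
open import Relation.Nullary using (¬_; yes; no)
open import Relation.Nullary.Decidable using (⌊_⌋)
open import Relation.Binary.PropositionalEquality using (_≡_)
open import Data.Bool using (Bool; true; false; _∧_; if_then_else_)

-- Polynomials in x^{±1} and q (finite formal sums of monomials).
-- A term  (m , n , c)  stands for  c · x^m · q^n  (m ∈ ℤ, n ∈ ℕ, c ∈ ℤ).
-- A polynomial is a list of terms, read as their (formal) sum.

Term : Set
Term = ℤ × ℕ × ℤ

Poly : Set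
Poly = List Term

coeff : ℤ → ℕ → Poly → ℤ
coeff m n [] = + 0
coeff m n ((m' , n' , c) ∷ p) =
  (if ⌊ m ≟ m' ⌋ ∧ ⌊ n ℕ.≟ n' ⌋ then c else + 0) ℤ.+ coeff m n p

mon : ℤ → ℤ → ℕ → Poly
mon c m n = (m , n , c) ∷ []

one : Poly
one = mon (+ 1) (+ 0) 0

_⊕_ : Poly → Poly → Poly
p ⊕ r = p ++ r

neg : Poly → Poly
neg = map (λ { (m , n , c) → (m , n , - c) })

_⊗_ : Poly → Poly → Poly
p ⊗ r = concatMap (λ { (m , n , c) → map (λ { (m' , n' , c') → (m ℤ.+ m' , n ℕ.+ n' , c ℤ.* c') }) r }) p

infixl 6 _⊕_
infixl 7 _⊗_

pow : Poly → ℕ → Poly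
pow p zero = one
pow p (suc k) = pow p k ⊗ p

prodP : ℕ → (ℕ → Poly) → Poly
prodP zero f = one
prodP (suc k) f = prodP k f ⊗ f k

sumP≤ : ℕ → (ℕ → Poly) → Poly
sumP≤ zero f = f 0
sumP≤ (suc N) f = sumP≤ N f ⊕ f (suc N)

qPoch : Poly → Poly → ℕ → Poly
qPoch a q k = prodP k (λ j → one ⊕ neg (a ⊗ pow q j))

-- truncated geometric series 1/(1 - t) ≈ ∑_{0≤i≤N} t^i
geom : ℕ → Poly → Poly
geom N t = sumP≤ N (λ i → pow t i)

qPochInv : ℕ → Poly → Poly → ℕ → Poly
qPochInv N a q k = prodP k (λ j → geom N (a ⊗ pow q j))

X Xinv Q : Poly
X = mon (+ 1) (+ 1) 0
Xinv = mon (+ 1) (-[1+ 0 ]) 0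
Q = mon (+ 1) (+ 0) 1

-- Truncation at q-degree N of
--   W = ∑_{k≥0} (-xq,-x^{-1}q;q^2)_k q^{2k} / (q;-q)_{2k+1}
-- All omitted terms have q-degree > N (k > N contributes q-degree ≥ 2k,
-- geometric terms with i > N contribute q-degree ≥ i), so the
-- coefficient of x^m q^n with n ≤ N is exact.
Wtrunc : ℕ → Poly
Wtrunc N = sumP≤ N (λ k →
  qPoch (neg (X ⊗ Q)) (pow Q 2) k ⊗ qPoch (neg (Xinv ⊗ Q)) (pow Q 2) k
    ⊗ pow Q (2 ℕ.* k)
    ⊗ qPochInv N Q (neg Q) (2 ℕ.* k ℕ.+ 1))

-- Truncation at q-degree N of
--   Z = ∑_{k≥0} (-xq,-x^{-1}q;q)_k q^k / (q;q)_{2k+1}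
Ztrunc : ℕ → Poly
Ztrunc N = sumP≤ N (λ k →
  qPoch (neg (X ⊗ Q)) Q k ⊗ qPoch (neg (Xinv ⊗ Q)) Q k
    ⊗ pow Q k
    ⊗ qPochInv N Q Q (2 ℕ.* k ℕ.+ 1))

w : ℤ → ℕ → ℤ
w m n = coeff m n (Wtrunc n)

z : ℤ → ℕ → ℤ
z m n = coeff m n (Ztrunc n)

FiniteSupport : (ℤ → ℤ) → Set
FiniteSupport f = ∃[ B ] (∀ m → B ℕ.< ∣ m ∣ → f m ≡ + 0)

Symmetric : (ℤ → ℤ) → Set
Symmetric f = ∀ m → f m ≡ f (- m)

SupportInterval : (ℤ → ℤ) → ℤ → ℤ → Set
SupportInterval f a b =
  ¬ (f a ≡ + 0) × ¬ (f b ≡ + 0) × (∀ i → ¬ (f i ≡ + 0) → (a ℤ.≤ i × i ℤ.≤ b))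

Unimodal : (ℤ → ℤ) → Set
Unimodal f = FiniteSupport f ×
  (∀ a b → SupportInterval f a b →
    ∃[ p ] (a ℤ.≤ p × p ℤ.≤ b
      × (∀ i j → a ℤ.≤ i → i ℤ.≤ j → j ℤ.≤ p → f i ℤ.≤ f j)
      × (∀ i j → p ℤ.≤ i → i ℤ.≤ j → j ℤ.≤ b → f j ℤ.≤ f i)))

-- Let C n m be the coefficient of x^m in the product of the first n factors (1 + x q^a)(1 + q^a / x);
-- it is symmetric in m and obeys
--   C (n + 1) m = (1 + q^{2a}) C n m + q^a (C n (m - 1) + C n (m + 1)).
-- In both series the gaps are nonnegative already summand by summand.
--
-- For z this follows from the recurrence by induction on n: C n m - C n (m + 2) has nonnegative
-- coefficients, and so has (C n m - C n (m + 1)) / (q;q)ₙ, where the boundary term at m = 0 is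
-- controlled by (1 - x + x²) / (1 - x) = 1 + x² / (1 - x) with x = q^a.  The summand n = m shows that
-- z(m,·) - z(m+2,·) has positive coefficients from q^{m + m(m+1)/2} on, and z(m,·) vanishes below.
--
-- For w the finite Jacobi triple product C n m = q^{m²} (q²;q²)_{2n} / ((q²;q²)_{n-m} (q²;q²)_{n+m})
-- gives
--   (C n m - C n (m + 1)) / (q;-q)_{2n+1}
--     = q^{m²} (-q;q²)_{n+1} (1 - q^{2m+1}) (q²;q²)ₙ
--         / ((1 - q^{2n+1}) (q²;q²)_{n-m} (q²;q²)_{n+m+1}),
-- which is a product of a q²-binomial coefficient, factors 1 + q^i and factors 1 / (1 - q^i).
-- Its lowest terms, over all n ≥ m, show that w(m,·) - w(m+1,·) has positive coefficients from
-- q^{m² + 2m} on, and w(m,·) vanishes below.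
module Submission where

open import Defs
open import Algebra.Bundles using (AbelianGroup; CommutativeRing; CommutativeSemigroup)
import Algebra.Properties.CommutativeSemigroup
import Algebra.Properties.Group
import Algebra.Solver.Ring
open import Algebra.Solver.Ring.AlmostCommutativeRing
  using (_-Raw-AlmostCommutative⟶_; fromCommutativeRing)
open import Data.Bool using (true; false; _∧_; if_then_else_)
open import Data.Integer using (ℤ; +_; -[1+_])
import Data.Integer as ℤ
import Data.Integer.Properties as ℤ
import Data.Integer.Solver
open import Data.List using ([]; _∷_; _++_; map)
open import Data.List.Properties using (map-++; map-∘; map-cong; ++-assoc)
open import Data.Maybe using (Maybe; just; nothing)
open import Data.Nat using (ℕ; zero; suc; z≤n; s≤s)
import Data.Nat as ℕ
import Data.Nat.Properties as ℕ
import Data.Nat.Solver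
open import Data.Product using (_×_; _,_; proj₁; proj₂; ∃-syntax)
open import Data.Sum using (_⊎_; inj₁; inj₂)
open import Function using (_∘_)
open import Function.Bundles using (mk⇔)
open import Level using (0ℓ)
open import Relation.Binary.PropositionalEquality as ≡ using (_≡_; _≗_)
import Relation.Binary.Reasoning.Setoid as SetoidReasoning
open import Relation.Nullary using (¬_; yes; no; contradiction)
open import Relation.Nullary.Decidable using (⌊_⌋; isYes≗does; does-⇔)

module N = Data.Nat.Solver.+-*-Solver
module I = Data.Integer.Solver.+-*-Solver

-- Truncated power series, axiomatically

-- Power series modulo q^{order + 1}, with NonNeg referring to the coefficients up to q^order.
record TruncatedSeries : Set₁ where
  field
    commutativeRing : CommutativeRing 0ℓ 0ℓ
  open CommutativeRing commutativeRing public
  field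
    scalars : CommutativeRing.rawRing ℤ.+-*-commutativeRing
                -Raw-AlmostCommutative⟶ fromCommutativeRing commutativeRing
    NonNeg      : Carrier → Set
    NonNeg-resp : ∀ {f g} → f ≈ g → NonNeg f → NonNeg g
    NonNeg-+    : ∀ {f g} → NonNeg f → NonNeg g → NonNeg (f + g)
    NonNeg-*    : ∀ {f g} → NonNeg f → NonNeg g → NonNeg (f * g)
    q^_         : ℕ → Carrier
    q^-zero     : q^ 0 ≈ 1#
    q^-+        : ∀ a b → q^ (a ℕ.+ b) ≈ q^ a * q^ b
    q^-nonNeg   : ∀ e → NonNeg (q^ e)
    order       : ℕ
    q^-vanish   : ∀ {e} → order ℕ.< e → q^ e ≈ 0#
  infix 9 q^_

-- Products, geometric series and coefficientwise order for truncated series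

module SeriesAlgebra (T : TruncatedSeries) where
  open import Data.Nat using (_≤_; _<_)
  open TruncatedSeries T
  open SetoidReasoning setoid

  module S = _-Raw-AlmostCommutative⟶_ scalars

  fromℕ : ℕ → Carrier
  fromℕ zero = 0#
  fromℕ (suc zero) = 1#
  fromℕ (suc (suc n)) = 1# + fromℕ (suc n)

  -- Unlike S.⟦_⟧, this sends + 1 to 1# definitionally, which lets the ring
  -- solver recognise 1#.
  fromℤ : ℤ → Carrier
  fromℤ (+ n) = fromℕ n
  fromℤ -[1+ n ] = - fromℕ (suc n)

  fromℕ-scalar : ∀ n → fromℕ n ≈ S.⟦ + n ⟧
  fromℕ-scalar zero = sym S.0-homo
  fromℕ-scalar (suc zero) = sym S.1-homo
  fromℕ-scalar (suc (suc n)) =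
    trans (+-cong (sym S.1-homo) (fromℕ-scalar (suc n))) (sym (S.+-homo (+ 1) (+ suc n)))

  fromℤ-scalar : ∀ i → fromℤ i ≈ S.⟦ i ⟧
  fromℤ-scalar (+ n) = fromℕ-scalar n
  fromℤ-scalar -[1+ n ] = trans (-‿cong (fromℕ-scalar (suc n))) (sym (S.-‿homo (+ suc n)))

  coefficients : CommutativeRing.rawRing ℤ.+-*-commutativeRing
                   -Raw-AlmostCommutative⟶ fromCommutativeRing commutativeRing
  coefficients = record
    { ⟦_⟧    = fromℤ
    ; +-homo = λ i j → trans (fromℤ-scalar (i ℤ.+ j)) (trans (S.+-homo i j)
                 (+-cong (sym (fromℤ-scalar i)) (sym (fromℤ-scalar j))))
    ; *-homo = λ i j → trans (fromℤ-scalar (i ℤ.* j)) (trans (S.*-homo i j)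
                 (*-cong (sym (fromℤ-scalar i)) (sym (fromℤ-scalar j))))
    ; -‿homo = λ i → trans (fromℤ-scalar (ℤ.- i)) (trans (S.-‿homo i)
                 (-‿cong (sym (fromℤ-scalar i))))
    ; 0-homo = refl
    ; 1-homo = refl
    }

  coefficient≟ : ∀ i j → Maybe (fromℤ i ≈ fromℤ j)
  coefficient≟ i j with i ℤ.≟ j
  ... | yes ≡.refl = just refl
  ... | no _ = nothing

  module Solver = Algebra.Solver.Ring (CommutativeRing.rawRing ℤ.+-*-commutativeRing)
    (fromCommutativeRing commutativeRing) coefficients coefficient≟
  open Solver using (solve; _:=_; _:+_; _:*_; _:-_; :-_; con)

  congᵉ : ∀ {a b} → a ≡ b → q^ a ≈ q^ b
  congᵉ e = reflexive (≡.cong q^_ e)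

  infixl 8 _^_
  _^_ : Carrier → ℕ → Carrier
  s ^ zero = 1#
  s ^ suc k = s ^ k * s

  ∑ : ℕ → (ℕ → Carrier) → Carrier
  ∑ zero f = f 0
  ∑ (suc n) f = ∑ n f + f (suc n)

  ∏ : ℕ → (ℕ → Carrier) → Carrier
  ∏ zero f = 1#
  ∏ (suc n) f = ∏ n f * f n

  ∏-split : ∀ a b f → ∏ (a ℕ.+ b) f ≈ ∏ a f * ∏ b (λ i → f (a ℕ.+ i))
  ∏-split a zero f = trans (reflexive (≡.cong (λ n → ∏ n f) (ℕ.+-identityʳ a))) (sym (*-identityʳ _))
  ∏-split a (suc b) f = begin
    ∏ (a ℕ.+ suc b) f ≡⟨ ≡.cong (λ n → ∏ n f) (ℕ.+-suc a b) ⟩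
    ∏ (a ℕ.+ b) f * f (a ℕ.+ b) ≈⟨ *-congʳ (∏-split a b f) ⟩
    ∏ a f * ∏ b (λ i → f (a ℕ.+ i)) * f (a ℕ.+ b) ≈⟨ *-assoc _ _ _ ⟩
    ∏ a f * ∏ (suc b) (λ i → f (a ℕ.+ i)) ∎

  -- Singles out the factor of index `a`, which is the one that cancels in `gapFactorisation`.
  ∏-first : ∀ a b f →
    ∏ (a ℕ.+ suc b) f ≈ ∏ a f * (f a * ∏ b (λ i → f (a ℕ.+ suc i)))
  ∏-first a b f = trans (∏-split a (suc b) f) (*-congˡ (trans (∏-split 1 b (λ i → f (a ℕ.+ i)))
    (*-congʳ (trans (*-identityˡ _) (reflexive (≡.cong f (ℕ.+-identityʳ a)))))))

  ∏-inverse : ∀ n {f g} → (∀ i → f i * g i ≈ 1#) → ∏ n f * ∏ n g ≈ 1#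
  ∏-inverse zero e = *-identityˡ _
  ∏-inverse (suc n) {f} {g} e = begin
    ∏ n f * f n * (∏ n g * g n)
      ≈⟨ solve 4 (λ a b c d → a :* b :* (c :* d) := a :* c :* (b :* d)) refl _ _ _ _ ⟩
    ∏ n f * ∏ n g * (f n * g n) ≈⟨ *-cong (∏-inverse n e) (e n) ⟩
    1# * 1# ≈⟨ *-identityˡ _ ⟩
    1# ∎

  inverse-unique : ∀ {a b u} → a * u ≈ 1# → b * u ≈ 1# → a ≈ b
  inverse-unique {a} {b} {u} p r = begin
    a ≈⟨ *-identityʳ a ⟨
    a * 1# ≈⟨ *-congˡ r ⟨
    a * (b * u) ≈⟨ solve 3 (λ a b u → a :* (b :* u) := a :* u :* b) refl a b u ⟩
    a * u * b ≈⟨ *-congʳ p ⟩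
    1# * b ≈⟨ *-identityˡ b ⟩
    b ∎

  geometric : Carrier → Carrier
  geometric s = ∑ order (s ^_)

  ∑-geometric : ∀ n s → ∑ n (s ^_) * (1# - s) ≈ 1# - s ^ suc n
  ∑-geometric zero s =
    solve 1 (λ s → con (+ 1) :* (con (+ 1) :- s) := con (+ 1) :- con (+ 1) :* s) refl s
  ∑-geometric (suc n) s = begin
    (∑ n (s ^_) + s ^ n * s) * (1# - s)
      ≈⟨ distribʳ _ _ _ ⟩
    ∑ n (s ^_) * (1# - s) + s ^ n * s * (1# - s)
      ≈⟨ +-congʳ (∑-geometric n s) ⟩
    1# - s ^ n * s + s ^ n * s * (1# - s)
      ≈⟨ solve 2 (λ a s → con (+ 1) :- a :* s :+ a :* s :* (con (+ 1) :- s)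
                       := con (+ 1) :- a :* s :* s) refl (s ^ n) s ⟩
    1# - s ^ n * s * s ∎

  ^-q^ : ∀ k s → (q^ 1 * s) ^ k ≈ q^ k * s ^ k
  ^-q^ zero s = sym (trans (*-identityʳ _) q^-zero)
  ^-q^ (suc k) s = begin
    (q^ 1 * s) ^ k * (q^ 1 * s) ≈⟨ *-congʳ (^-q^ k s) ⟩
    q^ k * s ^ k * (q^ 1 * s)
      ≈⟨ solve 4 (λ a b c d → a :* b :* (c :* d) := c :* a :* (b :* d)) refl _ _ _ _ ⟩
    q^ 1 * q^ k * (s ^ k * s) ≈⟨ *-congʳ (q^-+ 1 k) ⟨
    q^ suc k * (s ^ k * s) ∎

  -- The telescoped sum leaves a remainder divisible by q^{order + 1}, which is zero. Thus the
  -- finite sum is an exact inverse once the ratio is divisible by q.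
  geometric-inverse : ∀ s → geometric (q^ 1 * s) * (1# - q^ 1 * s) ≈ 1#
  geometric-inverse s = begin
    geometric (q^ 1 * s) * (1# - q^ 1 * s) ≈⟨ ∑-geometric order (q^ 1 * s) ⟩
    1# - (q^ 1 * s) ^ suc order ≈⟨ +-congˡ (-‿cong (^-q^ (suc order) s)) ⟩
    1# - q^ suc order * s ^ suc order ≈⟨ +-congˡ (-‿cong (*-congʳ (q^-vanish ℕ.≤-refl))) ⟩
    1# - 0# * s ^ suc order
      ≈⟨ solve 1 (λ a → con (+ 1) :- con (+ 0) :* a := con (+ 1)) refl (s ^ suc order) ⟩
    1# ∎

  infix 4 _≽_
  -- Coefficientwise comparison up to q^`order`. A bound `f ≽ q^ e` is how strict positivity of one
  -- coefficient is recorded.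
  _≽_ : Carrier → Carrier → Set
  f ≽ g = NonNeg (f - g)

  1-nonNeg : NonNeg 1#
  1-nonNeg = NonNeg-resp q^-zero (q^-nonNeg 0)

  0-nonNeg : NonNeg 0#
  0-nonNeg = NonNeg-resp (q^-vanish ℕ.≤-refl) (q^-nonNeg (suc order))

  ≽-resp : ∀ {f f′ g g′} → f ≈ f′ → g ≈ g′ → f ≽ g → f′ ≽ g′
  ≽-resp e e′ = NonNeg-resp (+-cong e (-‿cong e′))

  ≽-reflexive : ∀ {f g} → f ≈ g → f ≽ g
  ≽-reflexive {f} {g} e =
    NonNeg-resp (trans (sym (-‿inverseʳ g)) (+-congʳ (sym e))) 0-nonNeg

  ≽-trans : ∀ {f g h} → f ≽ g → g ≽ h → f ≽ h
  ≽-trans {f} {g} {h} p r =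
    NonNeg-resp (solve 3 (λ f g h → f :- g :+ (g :- h) := f :- h) refl f g h) (NonNeg-+ p r)

  ≽-nonNeg : ∀ {f g} → f ≽ g → NonNeg g → NonNeg f
  ≽-nonNeg {f} {g} p r =
    NonNeg-resp (solve 2 (λ f g → f :- g :+ g := f) refl f g) (NonNeg-+ p r)

  ≽0 : ∀ {f} → NonNeg f → f ≽ 0#
  ≽0 = NonNeg-resp (solve 1 (λ f → f := f :- con (+ 0)) refl _)

  +-mono-≽ : ∀ {f f′ g g′} → f ≽ f′ → g ≽ g′ → f + g ≽ f′ + g′
  +-mono-≽ {f} {f′} {g} {g′} p r = NonNeg-resp
    (solve 4 (λ f f′ g g′ → f :- f′ :+ (g :- g′) := f :+ g :- (f′ :+ g′)) refl f f′ g g′)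
    (NonNeg-+ p r)

  +-≽ˡ : ∀ {f g h} → f ≽ h → NonNeg g → f + g ≽ h
  +-≽ˡ p r = ≽-resp refl (+-identityʳ _) (+-mono-≽ p (≽0 r))

  -- By f g - f′ g′ = f (g - g′) + (f - f′) g′, where only `f` and `g′` occur outside a difference.
  *-mono-≽ : ∀ {f f′ g g′} → NonNeg f → NonNeg g′ → f ≽ f′ → g ≽ g′ → f * g ≽ f′ * g′
  *-mono-≽ {f} {f′} {g} {g′} nf ng′ p r = NonNeg-resp
    (solve 4 (λ f f′ g g′ → f :* (g :- g′) :+ (f :- f′) :* g′ := f :* g :- f′ :* g′)
      refl f f′ g g′)
    (NonNeg-+ (NonNeg-* nf r) (NonNeg-* p ng′))

  ≽1-nonNeg : ∀ {f} → f ≽ 1# → NonNeg f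
  ≽1-nonNeg p = ≽-nonNeg p 1-nonNeg

  *-≽1 : ∀ {f g} → f ≽ 1# → g ≽ 1# → f * g ≽ 1#
  *-≽1 p r = ≽-resp refl (*-identityˡ _) (*-mono-≽ (≽1-nonNeg p) 1-nonNeg p r)

  -- Lets a factor that is at least 1 be dropped from a lower bound.
  *-≽ˡ : ∀ {f g h} → NonNeg f → f ≽ h → g ≽ 1# → f * g ≽ h
  *-≽ˡ nf p r = ≽-resp refl (*-identityʳ _) (*-mono-≽ nf 1-nonNeg p r)

  *-≽ʳ : ∀ {f g h} → f ≽ 1# → NonNeg h → g ≽ h → f * g ≽ h
  *-≽ʳ p nh r = ≽-resp refl (*-identityˡ _) (*-mono-≽ (≽1-nonNeg p) nh p r)

  1+q^≽1 : ∀ e → 1# + q^ e ≽ 1#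
  1+q^≽1 e = +-≽ˡ (≽-reflexive refl) (q^-nonNeg e)

  ∏-≽1 : ∀ n {f} → (∀ i → f i ≽ 1#) → ∏ n f ≽ 1#
  ∏-≽1 zero p = ≽-reflexive refl
  ∏-≽1 (suc n) p = *-≽1 (∏-≽1 n p) (p n)

  ∑-≽1 : ∀ n {f} → f 0 ≽ 1# → (∀ i → NonNeg (f i)) → ∑ n f ≽ 1#
  ∑-≽1 zero p r = p
  ∑-≽1 (suc n) p r = +-≽ˡ (∑-≽1 n p r) (r (suc n))

  ∑-- : ∀ n f g → ∑ n f - ∑ n g ≈ ∑ n (λ i → f i - g i)
  ∑-- zero f g = refl
  ∑-- (suc n) f g = trans
    (solve 4 (λ a b c d → a :+ b :- (c :+ d) := a :- c :+ (b :- d)) refl _ _ _ _)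
    (+-congʳ (∑-- n f g))

  ∑-nonNeg : ∀ n {f} → (∀ i → NonNeg (f i)) → NonNeg (∑ n f)
  ∑-nonNeg zero p = p 0
  ∑-nonNeg (suc n) p = NonNeg-+ (∑-nonNeg n p) (p (suc n))

  ∑-≽-term : ∀ {n j f} → (∀ i → NonNeg (f i)) → j ≤ n → ∑ n f ≽ f j
  ∑-≽-term {zero} {zero} p z≤n = ≽-reflexive refl
  ∑-≽-term {suc n} {j} {f} p j≤ with j ℕ.≟ suc n
  ... | yes ≡.refl = ≽-resp (+-comm _ _) refl (+-≽ˡ (≽-reflexive refl) (∑-nonNeg n p))
  ... | no j≢ = +-≽ˡ (∑-≽-term p (ℕ.≤-pred (ℕ.≤∧≢⇒< j≤ j≢))) (p (suc n))

  ∑-zero : ∀ n {f} → (∀ i → f i ≈ 0#) → ∑ n f ≈ 0#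
  ∑-zero zero p = p 0
  ∑-zero (suc n) p = trans (+-cong (∑-zero n p) (p (suc n))) (+-identityˡ _)

  q^1^ : ∀ j → q^ 1 ^ j ≈ q^ j
  q^1^ zero = sym q^-zero
  q^1^ (suc j) = begin
    q^ 1 ^ j * q^ 1 ≈⟨ *-congʳ (q^1^ j) ⟩
    q^ j * q^ 1 ≈⟨ q^-+ j 1 ⟨
    q^ (j ℕ.+ 1) ≈⟨ congᵉ (ℕ.+-comm j 1) ⟩
    q^ suc j ∎

  -- The factor 1 / (1 - q^{j+1}) of 1 / (q;q)ₙ, in the shape that `qPochInv` produces.
  g : ℕ → Carrier
  g j = geometric (q^ 1 * q^ 1 ^ j)

  q^1*q^1^ : ∀ j → q^ 1 * q^ 1 ^ j ≈ q^ suc j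
  q^1*q^1^ j = trans (*-congˡ (q^1^ j)) (sym (q^-+ 1 j))

  g-inverse : ∀ j → g j * (1# - q^ suc j) ≈ 1#
  g-inverse j = trans (*-congˡ (+-congˡ (-‿cong (sym (q^1*q^1^ j))))) (geometric-inverse _)

  ^-nonNeg : ∀ {s} k → NonNeg s → NonNeg (s ^ k)
  ^-nonNeg zero p = 1-nonNeg
  ^-nonNeg (suc k) p = NonNeg-* (^-nonNeg k p) p

  g-factor-nonNeg : ∀ j i → NonNeg ((q^ 1 * q^ 1 ^ j) ^ i)
  g-factor-nonNeg j i = ^-nonNeg i (NonNeg-* (q^-nonNeg 1) (^-nonNeg j (q^-nonNeg 1)))

  g≽1 : ∀ j → g j ≽ 1#
  g≽1 j = ∑-≽1 order (≽-reflexive refl) (g-factor-nonNeg j)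

  g-nonNeg : ∀ j → NonNeg (g j)
  g-nonNeg j = ≽1-nonNeg (g≽1 j)

  -- 1 / (1 - q) contains every power of q. An exponent beyond `order` gives zero, so nonnegativity
  -- of `g 0` is enough there.
  g₀≽q^ : ∀ e → g 0 ≽ q^ e
  g₀≽q^ e with e ℕ.≤? order
  ... | yes e≤ = ≽-resp refl (trans (^-q^ e 1#) (trans (*-congˡ (1^ e)) (*-identityʳ _)))
                   (∑-≽-term (g-factor-nonNeg 0) e≤)
    where
    1^ : ∀ k → 1# ^ k ≈ 1#
    1^ zero = refl
    1^ (suc k) = trans (*-identityʳ _) (1^ k)
  ... | no e≰ = ≽-resp refl (sym (q^-vanish (ℕ.≰⇒> e≰))) (≽0 (g-nonNeg 0))

  -- C k m is the coefficient of x^m and of x^{-m} in ∏_{j < k} (1 + x q^{a j})(1 + x⁻¹ q^{a j}).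
  module Coefficient (a : ℕ → ℕ) where

    x : ℕ → Carrier
    x k = q^ a k

    C : ℕ → ℕ → Carrier
    C zero zero = 1#
    C zero (suc m) = 0#
    C (suc k) zero = (1# + x k * x k) * C k 0 + x k * (C k 1 + C k 1)
    C (suc k) (suc m) = (1# + x k * x k) * C k (suc m) + x k * (C k m + C k (suc (suc m)))

    C-vanish : ∀ n m → n < m → C n m ≈ 0#
    C-vanish zero (suc m) p = refl
    C-vanish (suc n) (suc m) (s≤s p) = begin
      (1# + x n * x n) * C n (suc m) + x n * (C n m + C n (suc (suc m)))
        ≈⟨ +-cong (*-congˡ (C-vanish n (suc m) (ℕ.m≤n⇒m≤1+n p)))
             (*-congˡ (+-cong (C-vanish n m p)
               (C-vanish n (suc (suc m)) (ℕ.m≤n⇒m≤1+n (ℕ.m≤n⇒m≤1+n p))))) ⟩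
      (1# + x n * x n) * 0# + x n * (0# + 0#)
        ≈⟨ solve 1 (λ x → (con (+ 1) :+ x :* x) :* con (+ 0) :+ x :* (con (+ 0) :+ con (+ 0))
                       := con (+ 0)) refl (x n) ⟩
      0# ∎

-- The series for z: nonnegative gaps, strict gaps and vanishing

module ZSeries (T : TruncatedSeries) where
  open import Data.Nat using (_≤_; _<_)
  open TruncatedSeries T
  open SetoidReasoning setoid
  open SeriesAlgebra T
  open Solver using (solve; _:=_; _:+_; _:*_; _:-_; :-_; con)

  open Coefficient suc

  -- 1 / (q;q)ₙ.
  G : ℕ → Carrier
  G n = ∏ n g

  -- Induction on `n`: for m > 0 the recurrence writes the gap as a nonnegative combination of three
  -- earlier gaps. The factor `G n` serves m = 0; already C 1 0 - C 1 1 = 1 - q + q² has a negative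
  -- coefficient.
  C-gap₁-nonNeg : ∀ n m → NonNeg (G n * (C n m - C n (suc m)))
  C-gap₁-nonNeg zero zero =
    NonNeg-resp (solve 0 (con (+ 1) := con (+ 1) :* (con (+ 1) :- con (+ 0))) refl) 1-nonNeg
  C-gap₁-nonNeg zero (suc m) =
    NonNeg-resp (solve 0 (con (+ 0) := con (+ 1) :* (con (+ 0) :- con (+ 0))) refl) 0-nonNeg
  C-gap₁-nonNeg (suc n) zero = NonNeg-resp (sym eq)
    (NonNeg-+ (NonNeg-* (NonNeg-+ 1-nonNeg (NonNeg-* (g-nonNeg n) (NonNeg-* nx nx))) (C-gap₁-nonNeg n 0))
              (NonNeg-* (NonNeg-* (g-nonNeg n) nx) (C-gap₁-nonNeg n 1)))
    where
    nx = q^-nonNeg (suc n)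
    -- Below m = 0 lies C n 1 by symmetry, so that gap enters with a minus sign and the coefficient
    -- becomes 1 - x + x². The new factor `g n` turns 1 - x into 1.
    eq : G n * g n * (C (suc n) 0 - C (suc n) 1) ≈
         (1# + g n * (x n * x n)) * (G n * (C n 0 - C n 1)) + g n * x n * (G n * (C n 1 - C n 2))
    eq = begin
      G n * g n * (C (suc n) 0 - C (suc n) 1)
        ≈⟨ solve 6 (λ G g x a b c →
             G :* g :* ((con (+ 1) :+ x :* x) :* a :+ x :* (b :+ b)
                        :- ((con (+ 1) :+ x :* x) :* b :+ x :* (a :+ c)))
             := (g :* (con (+ 1) :- x) :+ g :* (x :* x)) :* (G :* (a :- b)) :+ g :* x :* (G :* (b :- c)))
             refl (G n) (g n) (x n) (C n 0) (C n 1) (C n 2) ⟩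
      (g n * (1# - x n) + g n * (x n * x n)) * (G n * (C n 0 - C n 1)) + g n * x n * (G n * (C n 1 - C n 2))
        ≈⟨ +-congʳ (*-congʳ (+-congʳ (g-inverse n))) ⟩
      (1# + g n * (x n * x n)) * (G n * (C n 0 - C n 1)) + g n * x n * (G n * (C n 1 - C n 2)) ∎
  C-gap₁-nonNeg (suc n) (suc m) = NonNeg-resp
    (solve 7 (λ G g x a b c d →
       (con (+ 1) :+ x :* x) :* g :* (G :* (b :- c)) :+ x :* g :* (G :* (a :- b) :+ G :* (c :- d))
       := G :* g :* ((con (+ 1) :+ x :* x) :* b :+ x :* (a :+ c)
                     :- ((con (+ 1) :+ x :* x) :* c :+ x :* (b :+ d))))
       refl (G n) (g n) (x n) (C n m) (C n (1 ℕ.+ m)) (C n (2 ℕ.+ m)) (C n (3 ℕ.+ m)))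
    (NonNeg-+
      (NonNeg-* (NonNeg-* (NonNeg-+ 1-nonNeg (NonNeg-* nx nx)) (g-nonNeg n)) (C-gap₁-nonNeg n (suc m)))
      (NonNeg-* (NonNeg-* nx (g-nonNeg n)) (NonNeg-+ (C-gap₁-nonNeg n m) (C-gap₁-nonNeg n (2 ℕ.+ m)))))
    where nx = q^-nonNeg (suc n)

  -- For gaps of step two the reflected gap at m = 0 is C n 1 - C n 1 = 0, so the recurrence
  -- combines nonnegative terms only.
  C-gap₂-nonNeg : ∀ n m → NonNeg (C n m - C n (2 ℕ.+ m))
  C-gap₂-nonNeg zero zero = ≽0 1-nonNeg
  C-gap₂-nonNeg zero (suc m) = ≽0 0-nonNeg
  C-gap₂-nonNeg (suc n) zero = NonNeg-resp
    (solve 5 (λ x a b c d →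
       (con (+ 1) :+ x :* x) :* (a :- c) :+ x :* (b :- d)
       := (con (+ 1) :+ x :* x) :* a :+ x :* (b :+ b) :- ((con (+ 1) :+ x :* x) :* c :+ x :* (b :+ d)))
       refl (x n) (C n 0) (C n 1) (C n 2) (C n 3))
    (NonNeg-+ (NonNeg-* (NonNeg-+ 1-nonNeg (NonNeg-* nx nx)) (C-gap₂-nonNeg n 0))
              (NonNeg-* nx (C-gap₂-nonNeg n 1)))
    where nx = q^-nonNeg (suc n)
  C-gap₂-nonNeg (suc n) (suc m) = NonNeg-resp
    (solve 6 (λ x a b c d e →
       (con (+ 1) :+ x :* x) :* (b :- d) :+ x :* (a :- c :+ (c :- e))
       := (con (+ 1) :+ x :* x) :* b :+ x :* (a :+ c) :- ((con (+ 1) :+ x :* x) :* d :+ x :* (c :+ e)))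
       refl (x n) (C n m) (C n (1 ℕ.+ m)) (C n (2 ℕ.+ m)) (C n (3 ℕ.+ m)) (C n (4 ℕ.+ m)))
    (NonNeg-+ (NonNeg-* (NonNeg-+ 1-nonNeg (NonNeg-* nx nx)) (C-gap₂-nonNeg n (suc m)))
              (NonNeg-* nx (NonNeg-+ (C-gap₂-nonNeg n m) (C-gap₂-nonNeg n (2 ℕ.+ m)))))
    where nx = q^-nonNeg (suc n)

  tri : ℕ → ℕ
  tri zero = 0
  tri (suc m) = suc m ℕ.+ tri m

  -- The top power x^m arises only by taking x q^{j+1} from every factor 1 + x q^{j+1}.
  C-diagonal : ∀ m → C m m ≈ q^ tri m
  C-diagonal zero = sym q^-zero
  C-diagonal (suc m) = begin
    (1# + x m * x m) * C m (suc m) + x m * (C m m + C m (suc (suc m)))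
      ≈⟨ +-cong (*-congˡ (C-vanish m (suc m) ℕ.≤-refl))
           (*-congˡ (+-cong (C-diagonal m) (C-vanish m (suc (suc m)) (ℕ.m≤n⇒m≤1+n ℕ.≤-refl)))) ⟩
    (1# + x m * x m) * 0# + x m * (q^ tri m + 0#)
      ≈⟨ solve 2 (λ x a → (con (+ 1) :+ x :* x) :* con (+ 0) :+ x :* (a :+ con (+ 0)) := x :* a)
           refl (x m) (q^ tri m) ⟩
    x m * q^ tri m ≈⟨ q^-+ (suc m) (tri m) ⟨
    q^ tri (suc m) ∎

  -- Reaching x^m takes at least m distinct exponents among 1, 2, 3, ..., whose sum is at least
  -- `tri m`.
  C-divisible : ∀ n m → ∃[ d ] C n m ≈ q^ tri m * d
  C-divisible n zero = C n 0 , sym (trans (*-congʳ q^-zero) (*-identityˡ _))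
  C-divisible zero (suc m) = 0# , sym (zeroʳ _)
  C-divisible (suc n) (suc m)
    with m ℕ.≤? n | C-divisible n m | C-divisible n (suc m) | C-divisible n (2 ℕ.+ m)
  ... | no m≰n | _ | _ | _ = 0# , trans (C-vanish (suc n) (suc m) (s≤s (ℕ.≰⇒> m≰n))) (sym (zeroʳ _))
  ... | yes m≤n | d₀ , e₀ | d₁ , e₁ | d₂ , e₂ =
    -- One summand for each neighbour in the recurrence: q^{n-m} is the surplus of x n q^{tri m}
    -- over q^{tri (m+1)}, and q^{m+2} that of q^{tri (m+2)} over q^{tri (m+1)}.
    (1# + x n * x n) * d₁ + q^ (n ℕ.∸ m) * d₀ + x n * (q^ (2 ℕ.+ m) * d₂) , (begin
      (1# + x n * x n) * C n (suc m) + x n * (C n m + C n (2 ℕ.+ m))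
        ≈⟨ +-cong (*-congˡ e₁) (*-congˡ (+-cong e₀ (trans e₂ (*-congʳ (q^-+ (2 ℕ.+ m) (tri (suc m))))))) ⟩
      (1# + x n * x n) * (q^ tri (suc m) * d₁)
        + x n * (q^ tri m * d₀ + q^ (2 ℕ.+ m) * q^ tri (suc m) * d₂)
        ≈⟨ solve 7 (λ x t t₁ s d₀ d₁ d₂ →
             (con (+ 1) :+ x :* x) :* (t₁ :* d₁) :+ x :* (t :* d₀ :+ s :* t₁ :* d₂)
             := t₁ :* ((con (+ 1) :+ x :* x) :* d₁) :+ x :* t :* d₀ :+ t₁ :* (x :* (s :* d₂)))
             refl (x n) (q^ tri m) (q^ tri (suc m)) (q^ (2 ℕ.+ m)) d₀ d₁ d₂ ⟩
      q^ tri (suc m) * ((1# + x n * x n) * d₁) + x n * q^ tri m * d₀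
        + q^ tri (suc m) * (x n * (q^ (2 ℕ.+ m) * d₂))
        ≈⟨ +-congʳ (+-congˡ (*-congʳ exponents)) ⟩
      q^ tri (suc m) * ((1# + x n * x n) * d₁) + q^ tri (suc m) * q^ (n ℕ.∸ m) * d₀
        + q^ tri (suc m) * (x n * (q^ (2 ℕ.+ m) * d₂))
        ≈⟨ solve 5 (λ t a b c d → t :* a :+ t :* b :* c :+ t :* d := t :* (a :+ b :* c :+ d))
             refl _ _ _ _ _ ⟩
      q^ tri (suc m) * ((1# + x n * x n) * d₁ + q^ (n ℕ.∸ m) * d₀ + x n * (q^ (2 ℕ.+ m) * d₂)) ∎)
    where
    exponents : x n * q^ tri m ≈ q^ tri (suc m) * q^ (n ℕ.∸ m)
    exponents = begin
      q^ suc n * q^ tri m ≈⟨ q^-+ (suc n) (tri m) ⟨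
      q^ (suc n ℕ.+ tri m) ≡⟨ ≡.cong (λ k → q^ (suc k ℕ.+ tri m)) (≡.sym (ℕ.m+[n∸m]≡n m≤n)) ⟩
      q^ (suc (m ℕ.+ (n ℕ.∸ m)) ℕ.+ tri m)
        ≡⟨ ≡.cong q^_ (N.solve 3
             (λ m k t → N.con 1 N.:+ (m N.:+ k) N.:+ t N.:= N.con 1 N.:+ m N.:+ t N.:+ k)
             ≡.refl m (n ℕ.∸ m) (tri m)) ⟩
      q^ (tri (suc m) ℕ.+ (n ℕ.∸ m)) ≈⟨ q^-+ (tri (suc m)) (n ℕ.∸ m) ⟩
      q^ tri (suc m) * q^ (n ℕ.∸ m) ∎

  -- The coefficient of x^m in the summand of index n, associated as in the conclusion of `term-[]`.
  zTerm : ℕ → ℕ → Carrier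
  zTerm m n = ∏ (2 ℕ.* n ℕ.+ 1) g * (q^ n * C n m)

  zSeries : ℕ → Carrier
  zSeries m = ∑ order (zTerm m)

  -- The first n of the 2n + 1 factors of 1 / (q;q)_{2n+1} are spent on `C-gap₁-nonNeg`; the
  -- remaining ones are nonnegative.
  zTerm-gap₁ : ∀ m n → zTerm m n ≽ zTerm (suc m) n
  zTerm-gap₁ m n = NonNeg-resp eq
    (NonNeg-* (NonNeg-* (q^-nonNeg n) (≽1-nonNeg (∏-≽1 (n ℕ.+ 0 ℕ.+ 1) (λ i → g≽1 (n ℕ.+ i)))))
      (C-gap₁-nonNeg n m))
    where
    rest = ∏ (n ℕ.+ 0 ℕ.+ 1) (λ i → g (n ℕ.+ i))
    split : ∏ (2 ℕ.* n ℕ.+ 1) g ≈ G n * rest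
    split = trans (reflexive (≡.cong (λ k → ∏ k g) (ℕ.+-assoc n (n ℕ.+ 0) 1))) (∏-split n _ g)
    eq : q^ n * rest * (G n * (C n m - C n (suc m))) ≈ zTerm m n - zTerm (suc m) n
    eq = begin
      q^ n * rest * (G n * (C n m - C n (suc m)))
        ≈⟨ solve 5 (λ q r G a b → q :* r :* (G :* (a :- b)) := G :* r :* (q :* a) :- G :* r :* (q :* b))
             refl (q^ n) rest (G n) (C n m) (C n (suc m)) ⟩
      G n * rest * (q^ n * C n m) - G n * rest * (q^ n * C n (suc m))
        ≈⟨ +-cong (*-congʳ split) (-‿cong (*-congʳ split)) ⟨
      zTerm m n - zTerm (suc m) n ∎

  zTerm-gap₂ : ∀ m n →
    ∏ (2 ℕ.* n ℕ.+ 1) g * (q^ n * (C n m - C n (2 ℕ.+ m))) ≈ zTerm m n - zTerm (2 ℕ.+ m) n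
  zTerm-gap₂ m n = solve 4 (λ K q a b → K :* (q :* (a :- b)) := K :* (q :* a) :- K :* (q :* b))
    refl _ (q^ n) (C n m) (C n (2 ℕ.+ m))

  zTerm-gap₂-nonNeg : ∀ m n → zTerm m n ≽ zTerm (2 ℕ.+ m) n
  zTerm-gap₂-nonNeg m n = NonNeg-resp (zTerm-gap₂ m n)
    (NonNeg-* (≽1-nonNeg (∏-≽1 (2 ℕ.* n ℕ.+ 1) g≽1)) (NonNeg-* (q^-nonNeg n) (C-gap₂-nonNeg n m)))

  -- For n = m the gap is q^{m + tri m} / (q;q)_{2m+1}, and the factor 1 / (1 - q) supplies the
  -- missing power of q.
  zTerm-gap₂-diagonal : ∀ m e → m ℕ.+ tri m ≤ e → zTerm m m - zTerm (2 ℕ.+ m) m ≽ q^ e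
  zTerm-gap₂-diagonal m e p = ≽-resp
    (begin
      ∏ (2 ℕ.* m ℕ.+ 1) g * q^ (m ℕ.+ tri m) ≈⟨ *-congˡ (q^-+ m (tri m)) ⟩
      ∏ (2 ℕ.* m ℕ.+ 1) g * (q^ m * q^ tri m)
        ≈⟨ *-congˡ (*-congˡ (trans (+-cong (C-diagonal m)
             (-‿cong (C-vanish m (2 ℕ.+ m) (ℕ.m≤n⇒m≤1+n ℕ.≤-refl))))
             (solve 1 (λ a → a :- con (+ 0) := a) refl _))) ⟨
      ∏ (2 ℕ.* m ℕ.+ 1) g * (q^ m * (C m m - C m (2 ℕ.+ m))) ≈⟨ zTerm-gap₂ m m ⟩
      zTerm m m - zTerm (2 ℕ.+ m) m ∎)
    (trans (sym (q^-+ (e ℕ.∸ (m ℕ.+ tri m)) _)) (congᵉ (ℕ.m∸n+n≡m p)))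
    (*-mono-≽ (≽1-nonNeg (∏-≽1 (2 ℕ.* m ℕ.+ 1) g≽1)) (q^-nonNeg _) product≽ (≽-reflexive refl))
    where
    product≽ : ∏ (2 ℕ.* m ℕ.+ 1) g ≽ q^ (e ℕ.∸ (m ℕ.+ tri m))
    product≽ = ≽-resp
      (trans (sym (∏-split 1 (2 ℕ.* m) g)) (reflexive (≡.cong (λ k → ∏ k g) (ℕ.+-comm 1 (2 ℕ.* m))))) refl
      (*-≽ˡ (NonNeg-* 1-nonNeg (g-nonNeg 0))
        (≽-resp (sym (*-identityˡ _)) refl (g₀≽q^ _)) (∏-≽1 (2 ℕ.* m) (λ i → g≽1 (suc i))))

  zSeries-decreasing : ∀ m → zSeries m ≽ zSeries (suc m)
  zSeries-decreasing m = NonNeg-resp (sym (∑-- order _ _)) (∑-nonNeg order (zTerm-gap₁ m))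

  zSeries-gap : ∀ m → m ℕ.+ tri m ≤ order → zSeries m - zSeries (2 ℕ.+ m) ≽ q^ order
  zSeries-gap m p = ≽-resp (sym (∑-- order _ _)) refl
    (≽-trans
      (∑-≽-term {f = λ n → zTerm m n - zTerm (2 ℕ.+ m) n} (zTerm-gap₂-nonNeg m)
        (ℕ.≤-trans (ℕ.m≤m+n m _) p))
      (zTerm-gap₂-diagonal m order p))

  -- Summands with n < m vanish and the others are divisible by q^{n + tri m}. The threshold is
  -- exactly the one of `zSeries-gap`, so together they cover all cases.
  zSeries-vanish : ∀ m → order < m ℕ.+ tri m → zSeries m ≈ 0#
  zSeries-vanish m p = ∑-zero order term-vanish
    where
    term-vanish : ∀ n → zTerm m n ≈ 0#
    term-vanish n with m ℕ.≤? n
    ... | no m≰n = trans (*-congˡ (trans (*-congˡ (C-vanish n m (ℕ.≰⇒> m≰n))) (zeroʳ _))) (zeroʳ _)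
    ... | yes m≤n with d , e ← C-divisible n m = begin
      ∏ (2 ℕ.* n ℕ.+ 1) g * (q^ n * C n m) ≈⟨ *-congˡ (*-congˡ e) ⟩
      ∏ (2 ℕ.* n ℕ.+ 1) g * (q^ n * (q^ tri m * d))
        ≈⟨ *-congˡ (trans (sym (*-assoc _ _ _)) (*-congʳ (trans (sym (q^-+ n (tri m)))
             (q^-vanish (ℕ.<-≤-trans p (ℕ.+-monoˡ-≤ (tri m) m≤n)))))) ⟩
      ∏ (2 ℕ.* n ℕ.+ 1) g * (0# * d) ≈⟨ trans (*-congˡ (zeroˡ d)) (zeroʳ _) ⟩
      0# ∎

-- The series for w: the finite Jacobi triple product

module WSeries (T : TruncatedSeries) where
  open import Data.Nat using (_≤_; _<_)
  open TruncatedSeries T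
  open SetoidReasoning setoid
  open SeriesAlgebra T
  open Solver using (solve; _:=_; _:+_; _:*_; _:-_; :-_; con)

  open Coefficient (λ k → suc (k ℕ.+ k))

  dbl : ℕ → ℕ
  dbl n = n ℕ.+ n

  -- Y n = (q²;q²)ₙ and I n = 1 / Y n.
  Y I : ℕ → Carrier
  Y n = ∏ n (λ i → 1# - q^ (2 ℕ.+ dbl i))
  I n = ∏ n (λ i → g (suc (dbl i)))

  -- 1 / (q²;q²)_{c - 1}, with the convention 1 / (q²;q²)₋₁ = 0, which makes
  -- J-step hold at c = 0.
  J : ℕ → Carrier
  J zero = 0#
  J (suc c) = I c

  I*Y : ∀ n → I n * Y n ≈ 1#
  I*Y n = ∏-inverse n (λ i → g-inverse (suc (dbl i)))

  J-step : ∀ c → J c ≈ (1# - q^ dbl c) * J (suc c)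
  J-step zero = sym (trans (*-congʳ (trans (+-congˡ (-‿cong q^-zero)) (-‿inverseʳ _))) (zeroˡ _))
  J-step (suc c) = begin
    I c ≈⟨ *-identityʳ _ ⟨
    I c * 1# ≈⟨ *-congˡ (g-inverse (suc (dbl c))) ⟨
    I c * (g (suc (dbl c)) * (1# - q^ (2 ℕ.+ dbl c)))
      ≈⟨ solve 3 (λ a b c → a :* (b :* c) := c :* (a :* b)) refl _ _ _ ⟩
    (1# - q^ (2 ℕ.+ dbl c)) * I (suc c)
      ≡⟨ ≡.cong (λ k → (1# - q^ k) * I (suc c)) (≡.cong suc (≡.sym (ℕ.+-suc c c))) ⟩
    (1# - q^ dbl (suc c)) * I (suc c) ∎

  -- The recurrence for the closed form, reduced to an identity between polynomials. Once Q P j₂ b₂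
  -- is factored out, it reads (1 + s t y)(1 - s y)(1 - t y) + s y (1 - t)(1 - t y) + t y (1 - s)(1
  -- - s y) = (1 - s t y)(1 - s t y²).
  C-step : ∀ {x s t y Q P Cl Cm Cu j₀ j₁ j₂ b₀ b₁ b₂} →
    x * x ≈ s * t * y →
    j₀ ≈ (1# - s) * j₁ → j₁ ≈ (1# - s * y) * j₂ →
    b₀ ≈ (1# - t) * b₁ → b₁ ≈ (1# - t * y) * b₂ →
    x * Cl ≈ s * y * Q * (P * (j₂ * b₀)) →
    Cm ≈ Q * (P * (j₁ * b₁)) →
    x * Cu ≈ t * y * Q * (P * (j₀ * b₂)) →
    (1# + x * x) * Cm + x * (Cl + Cu)
      ≈ Q * (P * (1# - s * t * y) * (1# - s * t * y * y) * (j₂ * b₂))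
  C-step {x} {s} {t} {y} {Q} {P} {Cl} {Cm} {Cu} {j₀} {j₁} {j₂} {b₀} {b₁} {b₂}
    xx ej₀ ej₁ eb₀ eb₁ el em eu = begin
    (1# + x * x) * Cm + x * (Cl + Cu)
      ≈⟨ +-congˡ (distribˡ _ _ _) ⟩
    (1# + x * x) * Cm + (x * Cl + x * Cu)
      ≈⟨ +-cong (*-cong (+-congˡ xx) (trans em (*-congˡ (*-congˡ (*-cong ej₁ eb₁)))))
          (+-cong (trans el (*-congˡ (*-congˡ (*-congˡ (trans eb₀ (*-congˡ eb₁))))))
                  (trans eu (*-congˡ (*-congˡ (*-congʳ (trans ej₀ (*-congˡ ej₁))))))) ⟩
    (1# + s * t * y) * (Q * (P * ((1# - s * y) * j₂ * ((1# - t * y) * b₂))))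
      + (s * y * Q * (P * (j₂ * ((1# - t) * ((1# - t * y) * b₂))))
      + t * y * Q * (P * ((1# - s) * ((1# - s * y) * j₂) * b₂)))
      ≈⟨ +-cong (solve 5 (λ a Q P j b → a :* (Q :* (P :* (j :* b))) := Q :* P :* (a :* j :* b)) refl _ _ _ _ _)
          (+-cong (solve 5 (λ a Q P j b → a :* Q :* (P :* (j :* b)) := Q :* P :* (a :* j :* b)) refl _ _ _ _ _)
                  (solve 5 (λ a Q P j b → a :* Q :* (P :* (j :* b)) := Q :* P :* (a :* j :* b)) refl _ _ _ _ _)) ⟩
    Q * P * ((1# + s * t * y) * ((1# - s * y) * j₂) * ((1# - t * y) * b₂))
      + (Q * P * (s * y * j₂ * ((1# - t) * ((1# - t * y) * b₂)))
      + Q * P * (t * y * ((1# - s) * ((1# - s * y) * j₂)) * b₂))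
      ≈⟨ trans (+-congˡ (sym (distribˡ _ _ _))) (sym (distribˡ _ _ _)) ⟩
    Q * P * ((1# + s * t * y) * ((1# - s * y) * j₂) * ((1# - t * y) * b₂)
      + (s * y * j₂ * ((1# - t) * ((1# - t * y) * b₂))
      + t * y * ((1# - s) * ((1# - s * y) * j₂)) * b₂))
      ≈⟨ *-congˡ (solve 5 (λ s t y j b →
           (con (+ 1) :+ s :* t :* y) :* ((con (+ 1) :- s :* y) :* j) :* ((con (+ 1) :- t :* y) :* b)
           :+ (s :* y :* j :* ((con (+ 1) :- t) :* ((con (+ 1) :- t :* y) :* b))
           :+ t :* y :* ((con (+ 1) :- s) :* ((con (+ 1) :- s :* y) :* j)) :* b)
           := (con (+ 1) :- s :* t :* y) :* (con (+ 1) :- s :* t :* y :* y) :* (j :* b))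
           refl s t y j₂ b₂) ⟩
    Q * P * ((1# - s * t * y) * (1# - s * t * y * y) * (j₂ * b₂))
      ≈⟨ solve 5 (λ Q P a b j → Q :* P :* (a :* b :* j) := Q :* (P :* a :* b :* j)) refl _ _ _ _ _ ⟩
    Q * (P * (1# - s * t * y) * (1# - s * t * y * y) * (j₂ * b₂)) ∎

  q^-*₂ : ∀ a b {e} → a ℕ.+ b ≡ e → q^ a * q^ b ≈ q^ e
  q^-*₂ a b p = trans (sym (q^-+ a b)) (congᵉ p)

  q^-*₃ : ∀ a b c {e} → a ℕ.+ b ℕ.+ c ≡ e → q^ a * q^ b * q^ c ≈ q^ e
  q^-*₃ a b c p = trans (*-congʳ (sym (q^-+ a b))) (q^-*₂ (a ℕ.+ b) c p)

  -- The exponents are written as squares to match x² in the recurrence for `C`, and because `∏h*Y`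
  -- later splits 1 - a² and 1 - b².
  Y-step : ∀ n → Y (dbl (suc n)) ≈
    Y (dbl n) * (1# - q^ suc (dbl n) * q^ suc (dbl n)) * (1# - q^ (2 ℕ.+ dbl n) * q^ (2 ℕ.+ dbl n))
  Y-step n = trans (reflexive (≡.cong Y (≡.cong suc (ℕ.+-suc n n))))
    (*-cong (*-congˡ (+-congˡ (-‿cong (sym (q^-*₂ (suc (dbl n)) (suc (dbl n))
              (N.solve 1 (λ d → N.con 1 N.:+ d N.:+ (N.con 1 N.:+ d)
                N.:= N.con 2 N.:+ (d N.:+ d)) ≡.refl (dbl n)))))))
      (+-congˡ (-‿cong (sym (q^-*₂ (2 ℕ.+ dbl n) (2 ℕ.+ dbl n)
              (N.solve 1 (λ d → N.con 2 N.:+ d N.:+ (N.con 2 N.:+ d)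
                N.:= N.con 2 N.:+ (N.con 1 N.:+ d N.:+ (N.con 1 N.:+ d))) ≡.refl (dbl n)))))))

  -- The right-hand side of the triple product for c = n + 1 - m. The shift by one includes m = n +
  -- 1, where `J 0` makes it zero.
  closed : ℕ → ℕ → ℕ → Carrier
  closed n m c = q^ (m ℕ.* m) * (Y (dbl n) * (J c * J (suc (n ℕ.+ m))))

  -- The lower neighbour enters only through its product with x, in a form that fits both the index
  -- m - 1 and, for m = 0, the reflected index 1.
  C-closed-step : ∀ m c {Cl Cm Cu} → let n = m ℕ.+ c; x = q^ suc (dbl n) in
    x * Cl ≈ q^ dbl c * q^ 2 * q^ (m ℕ.* m) * (Y (dbl n) * (J (2 ℕ.+ c) * J (n ℕ.+ m))) →
    Cm ≈ closed n m (suc c) →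
    Cu ≈ closed n (suc m) c →
    (1# + x * x) * Cm + x * (Cl + Cu) ≈ closed (suc n) m (2 ℕ.+ c)
  C-closed-step m c {Cl} {Cm} {Cu} el em eu = trans
    -- With these values s t y = q^{4n+2} = x² and s t y² = q^{4n+4}, so the two factors gained are
    -- those by which `Y` grows.
    (C-step {s = q^ dbl c} {q^ dbl k} {q^ 2} {q^ (m ℕ.* m)} {Y (dbl n)} (sym xx)
      (J-step c) (trans (J-step (suc c)) (*-congʳ (+-congˡ (-‿cong (dbl-suc c)))))
      (J-step k) (trans (J-step (suc k)) (*-congʳ (+-congˡ (-‿cong (dbl-suc k)))))
      el em upper)
    (*-congˡ (*-congʳ (trans (*-cong (*-congˡ (+-congˡ (-‿cong xx))) (+-congˡ (-‿cong xx′)))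
      (sym (Y-step n)))))
    where
    n k : ℕ
    n = m ℕ.+ c
    k = n ℕ.+ m
    dbl-suc : ∀ i → q^ dbl (suc i) ≈ q^ dbl i * q^ 2
    dbl-suc i = sym (q^-*₂ (dbl i) 2
      (N.solve 1 (λ i → i N.:+ i N.:+ N.con 2 N.:= N.con 1 N.:+ i N.:+ (N.con 1 N.:+ i)) ≡.refl i))
    xx : q^ dbl c * q^ dbl k * q^ 2 ≈ q^ suc (dbl n) * q^ suc (dbl n)
    xx = trans (q^-*₃ (dbl c) (dbl k) 2
      (N.solve 2 (λ m c → let n = m N.:+ c; k = n N.:+ m in
         c N.:+ c N.:+ (k N.:+ k) N.:+ N.con 2
         N.:= N.con 1 N.:+ (n N.:+ n) N.:+ (N.con 1 N.:+ (n N.:+ n))) ≡.refl m c)) (q^-+ _ _)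
    xx′ : q^ dbl c * q^ dbl k * q^ 2 * q^ 2 ≈ q^ (2 ℕ.+ dbl n) * q^ (2 ℕ.+ dbl n)
    xx′ = trans (*-congʳ xx) (trans (*-congʳ (sym (q^-+ _ _))) (trans
      (q^-*₂ (suc (dbl n) ℕ.+ suc (dbl n)) 2 (N.solve 1 (λ d → N.con 1 N.:+ d N.:+ (N.con 1 N.:+ d) N.:+ N.con 2
         N.:= N.con 2 N.:+ d N.:+ (N.con 2 N.:+ d)) ≡.refl (dbl n))) (q^-+ _ _)))
    upper : q^ suc (dbl n) * Cu ≈ q^ dbl k * q^ 2 * q^ (m ℕ.* m) * (Y (dbl n) * (J c * J (2 ℕ.+ k)))
    upper = trans (*-congˡ eu) (trans (sym (*-assoc _ _ _)) (*-cong
      (trans (q^-*₂ (suc (dbl n)) (suc m ℕ.* suc m) ≡.refl) (sym (q^-*₃ (dbl k) 2 (m ℕ.* m)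
        (N.solve 2 (λ m c → let n = m N.:+ c; k = n N.:+ m in
          k N.:+ k N.:+ N.con 2 N.:+ m N.:* m
          N.:= N.con 1 N.:+ (n N.:+ n) N.:+ (N.con 1 N.:+ m) N.:* (N.con 1 N.:+ m)) ≡.refl m c))))
      (*-congˡ (*-congˡ (reflexive (≡.cong (λ i → J (suc i)) (ℕ.+-suc n m)))))))

  closed-diagonal : ∀ n → closed n n 1 ≈ q^ (n ℕ.* n)
  closed-diagonal n = begin
    q^ (n ℕ.* n) * (Y (dbl n) * (1# * I (dbl n)))
      ≈⟨ solve 3 (λ q y i → q :* (y :* (con (+ 1) :* i)) := q :* (i :* y)) refl _ _ _ ⟩
    q^ (n ℕ.* n) * (I (dbl n) * Y (dbl n)) ≈⟨ *-congˡ (I*Y (dbl n)) ⟩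
    q^ (n ℕ.* n) * 1# ≈⟨ *-identityʳ _ ⟩
    q^ (n ℕ.* n) ∎

  -- The finite Jacobi triple product.
  C-closed : ∀ n m c → m ℕ.+ c ≡ suc n → C n m ≈ closed n m c
  -- Here m = n + 1 and both sides vanish, the right one through `J 0`.
  C-closed n m zero e = trans
    (C-vanish n m (ℕ.≤-reflexive (≡.trans (≡.sym e) (ℕ.+-identityʳ m))))
    (sym (solve 3 (λ a b c → a :* (b :* (con (+ 0) :* c)) := con (+ 0)) refl _ _ _))
  C-closed zero zero (suc zero) e = sym (trans (closed-diagonal 0) q^-zero)
  C-closed zero (suc m) (suc c) e with () ← ≡.trans (≡.sym (ℕ.+-suc m c)) (ℕ.suc-injective e)
  C-closed (suc n) zero (suc zero) ()
  -- The corner of the new row: m = n, and of the three neighbours only C n n is nonzero.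
  C-closed (suc n) (suc m) (suc zero) e
    with ≡.refl ← ≡.trans (≡.sym (ℕ.+-comm m 1)) (ℕ.suc-injective e) = begin
    (1# + x n * x n) * C n (suc n) + x n * (C n n + C n (2 ℕ.+ n))
      ≈⟨ +-cong (*-congˡ (C-vanish n (suc n) ℕ.≤-refl)) (*-congˡ (+-cong
           (trans (C-closed n n 1 (ℕ.+-comm n 1)) (closed-diagonal n))
           (C-vanish n (2 ℕ.+ n) (ℕ.m≤n⇒m≤1+n ℕ.≤-refl)))) ⟩
    (1# + x n * x n) * 0# + x n * (q^ (n ℕ.* n) + 0#)
      ≈⟨ solve 2 (λ x a → (con (+ 1) :+ x :* x) :* con (+ 0) :+ x :* (a :+ con (+ 0)) := x :* a)
           refl (x n) _ ⟩
    x n * q^ (n ℕ.* n)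
      ≈⟨ q^-*₂ (suc (dbl n)) (n ℕ.* n) (N.solve 1 (λ n → N.con 1 N.:+ (n N.:+ n) N.:+ n N.:* n
           N.:= (N.con 1 N.:+ n) N.:* (N.con 1 N.:+ n)) ≡.refl n) ⟩
    q^ (suc n ℕ.* suc n) ≈⟨ closed-diagonal (suc n) ⟨
    closed (suc n) (suc n) 1 ∎
  -- At m = 0 both neighbours are C n 1; when it serves as the lower one, its two `J` factors trade
  -- places.
  C-closed (suc n) zero (suc (suc c)) e with ≡.refl ← ℕ.suc-injective (ℕ.suc-injective e) =
    C-closed-step 0 n {C n 1} {C n 0} {C n 1}
      (trans (*-congˡ upper) (trans (sym (*-assoc _ _ _)) (*-cong
        (trans (q^-*₂ (suc (dbl n)) 1 ≡.refl) (sym (q^-*₃ (dbl n) 2 0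
          (N.solve 1 (λ d → d N.:+ N.con 2 N.:+ N.con 0 N.:= N.con 1 N.:+ d N.:+ N.con 1) ≡.refl (dbl n)))))
        (*-congˡ (trans (*-comm _ _) (*-cong
          (reflexive (≡.cong (λ i → J (suc i)) (ℕ.+-comm n 1)))
          (reflexive (≡.cong J (≡.sym (ℕ.+-identityʳ n))))))))))
      (C-closed n 0 (suc n) ≡.refl)
      upper
    where upper = C-closed n 1 n ≡.refl
  C-closed (suc n) (suc m) (suc (suc c)) e
    with ≡.refl ← ≡.trans (≡.sym (≡.trans (ℕ.+-suc m (suc c)) (≡.cong suc (ℕ.+-suc m c))))
                    (ℕ.suc-injective e) =
    C-closed-step (suc m) c {C n m} {C n (suc m)} {C n (2 ℕ.+ m)}
      (trans (*-congˡ (C-closed n m (2 ℕ.+ c)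
          (≡.trans (ℕ.+-suc m (suc c)) (≡.cong suc (ℕ.+-suc m c)))))
        (trans (sym (*-assoc _ _ _)) (*-cong
          (trans (q^-*₂ (suc (dbl n)) (m ℕ.* m) ≡.refl) (sym (q^-*₃ (dbl c) 2 (suc m ℕ.* suc m)
            (N.solve 2 (λ m c → let n = N.con 1 N.:+ m N.:+ c in
              c N.:+ c N.:+ N.con 2 N.:+ (N.con 1 N.:+ m) N.:* (N.con 1 N.:+ m)
              N.:= N.con 1 N.:+ (n N.:+ n) N.:+ m N.:* m) ≡.refl m c))))
          (*-congˡ (*-congˡ (reflexive (≡.cong J (≡.sym (ℕ.+-suc n m)))))))))
      (C-closed n (suc m) (suc c) (≡.cong suc (ℕ.+-suc m c)))
      (C-closed n (2 ℕ.+ m) c ≡.refl)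

  -- Over a common denominator, with r = q^{2m+1} and x = q^{2n+1}, the numerators differ by 1 - r x
  -- - r + x = (1 - r)(1 + x).
  C-gap : ∀ m c → let n = m ℕ.+ c in
    C n m - C n (suc m) ≈
      q^ (m ℕ.* m) * Y (dbl n) * (I c * I (suc (n ℕ.+ m)))
        * (1# - q^ suc (dbl m)) * (1# + q^ suc (dbl n))
  C-gap m c = begin
    C n m - C n (suc m)
      ≈⟨ +-cong (C-closed n m (suc c) (ℕ.+-suc m c)) (-‿cong (C-closed n (suc m) c ≡.refl)) ⟩
    q^ (m ℕ.* m) * (Y (dbl n) * (I c * J (suc k)))
      - q^ (suc m ℕ.* suc m) * (Y (dbl n) * (J c * J (suc (n ℕ.+ suc m))))
      ≈⟨ +-cong (*-congˡ (*-congˡ (*-congˡ (J-step (suc k)))))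
           (-‿cong (*-cong (sym (q^-*₂ (m ℕ.* m) (suc (dbl m))
             (N.solve 1 (λ m → m N.:* m N.:+ (N.con 1 N.:+ (m N.:+ m))
               N.:= (N.con 1 N.:+ m) N.:* (N.con 1 N.:+ m)) ≡.refl m)))
             (*-congˡ (*-cong (J-step c) (reflexive (≡.cong (λ i → J (suc i)) (ℕ.+-suc n m))))))) ⟩
    q^ (m ℕ.* m) * (Y (dbl n) * (I c * ((1# - q^ dbl (suc k)) * I (suc k))))
      - q^ (m ℕ.* m) * q^ suc (dbl m) * (Y (dbl n) * ((1# - q^ dbl c) * I c * I (suc k)))
      ≈⟨ solve 7 (λ q r y a b s t →
           q :* (y :* (a :* ((con (+ 1) :- s) :* b))) :- q :* r :* (y :* ((con (+ 1) :- t) :* a :* b))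
           := q :* y :* (a :* b) :* (con (+ 1) :- s :- r :+ t :* r)) refl
           (q^ (m ℕ.* m)) (q^ suc (dbl m)) (Y (dbl n)) (I c) (I (suc k)) (q^ dbl (suc k)) (q^ dbl c) ⟩
    q^ (m ℕ.* m) * Y (dbl n) * (I c * I (suc k))
      * (1# - q^ dbl (suc k) - q^ suc (dbl m) + q^ dbl c * q^ suc (dbl m))
      ≈⟨ *-congˡ (+-cong (+-congʳ (+-congˡ (-‿cong (sym (q^-*₂ (suc (dbl m)) (suc (dbl n)) e₁)))))
           (q^-*₂ (dbl c) (suc (dbl m)) e₂)) ⟩
    q^ (m ℕ.* m) * Y (dbl n) * (I c * I (suc k))
      * (1# - q^ suc (dbl m) * q^ suc (dbl n) - q^ suc (dbl m) + q^ suc (dbl n))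
      ≈⟨ solve 3 (λ a r x → a :* (con (+ 1) :- r :* x :- r :+ x)
           := a :* (con (+ 1) :- r) :* (con (+ 1) :+ x)) refl
           _ (q^ suc (dbl m)) (q^ suc (dbl n)) ⟩
    q^ (m ℕ.* m) * Y (dbl n) * (I c * I (suc k)) * (1# - q^ suc (dbl m)) * (1# + q^ suc (dbl n)) ∎
    where
    n k : ℕ
    n = m ℕ.+ c
    k = n ℕ.+ m
    e₁ : suc (dbl m) ℕ.+ suc (dbl n) ≡ dbl (suc k)
    e₁ = N.solve 2 (λ m c → let n = m N.:+ c in
      N.con 1 N.:+ (m N.:+ m) N.:+ (N.con 1 N.:+ (n N.:+ n))
      N.:= N.con 1 N.:+ (n N.:+ m) N.:+ (N.con 1 N.:+ (n N.:+ m))) ≡.refl m c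
    e₂ : dbl c ℕ.+ suc (dbl m) ≡ suc (dbl n)
    e₂ = N.solve 2 (λ m c → c N.:+ c N.:+ (N.con 1 N.:+ (m N.:+ m))
      N.:= N.con 1 N.:+ (m N.:+ c N.:+ (m N.:+ c))) ≡.refl m c

  -- The denominators (q;-q)_{2n+1} and the factorisation of the gaps

  -- h j = 1 / (1 - q (-q)ʲ)
  h : ℕ → Carrier
  h j = geometric (q^ 1 * (- q^ 1) ^ j)

  ^-even : ∀ n → (- q^ 1) ^ dbl n ≈ q^ dbl n
  ^-even zero = sym q^-zero
  ^-even (suc n) = begin
    (- q^ 1) ^ dbl (suc n) ≡⟨ ≡.cong (λ i → (- q^ 1) ^ suc i) (ℕ.+-suc n n) ⟩
    (- q^ 1) ^ dbl n * - q^ 1 * - q^ 1 ≈⟨ *-congʳ (*-congʳ (^-even n)) ⟩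
    q^ dbl n * - q^ 1 * - q^ 1
      ≈⟨ solve 2 (λ a b → a :* :- b :* :- b := a :* b :* b) refl _ _ ⟩
    q^ dbl n * q^ 1 * q^ 1
      ≈⟨ q^-*₃ (dbl n) 1 1 (N.solve 1 (λ n → n N.:+ n N.:+ N.con 1 N.:+ N.con 1
           N.:= N.con 1 N.:+ n N.:+ (N.con 1 N.:+ n)) ≡.refl n) ⟩
    q^ dbl (suc n) ∎

  h-even-inverse : ∀ n → h (dbl n) * (1# - q^ suc (dbl n)) ≈ 1#
  h-even-inverse n = trans
    (*-congˡ (+-congˡ (-‿cong (sym (trans (*-congˡ (^-even n)) (q^-*₂ 1 (dbl n) ≡.refl))))))
    (geometric-inverse _)

  h-odd-inverse : ∀ n → h (suc (dbl n)) * (1# + q^ (2 ℕ.+ dbl n)) ≈ 1#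
  h-odd-inverse n = trans
    (*-congˡ (+-congˡ (begin
      q^ (2 ℕ.+ dbl n) ≈⟨ q^-*₃ 1 1 (dbl n) ≡.refl ⟨
      q^ 1 * q^ 1 * q^ dbl n ≈⟨ solve 2 (λ a b → a :* a :* b := :- (a :* (b :* :- a))) refl _ _ ⟩
      - (q^ 1 * (q^ dbl n * - q^ 1)) ≈⟨ -‿cong (*-congˡ (*-congʳ (^-even n))) ⟨
      - (q^ 1 * ((- q^ 1) ^ dbl n * - q^ 1)) ∎)))
    (geometric-inverse _)

  h-even : ∀ n → h (dbl n) ≈ g (dbl n)
  h-even n = inverse-unique (h-even-inverse n) (g-inverse (dbl n))

  -- (-q;q²)ₙ.
  odds : ℕ → Carrier
  odds n = ∏ n (λ i → 1# + q^ suc (dbl i))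

  -- With a = q^{2n+1} and b = q^{2n+2}, the new factors 1 - a² and 1 - b² lose 1 - a and 1 + b to
  -- the two new values of `h`. What remains is 1 + a for `odds` and 1 - b for `Y n`.
  ∏h*Y : ∀ n → ∏ (dbl n) h * Y (dbl n) ≈ odds n * Y n
  ∏h*Y zero = refl
  ∏h*Y (suc n) = begin
    ∏ (dbl (suc n)) h * Y (dbl (suc n))
      ≈⟨ *-cong (reflexive (≡.cong (λ i → ∏ (suc i) h) (ℕ.+-suc n n))) (Y-step n) ⟩
    ∏ (dbl n) h * h (dbl n) * h (suc (dbl n)) * (Y (dbl n) * (1# - a * a) * (1# - b * b))
      ≈⟨ solve 6 (λ P Y h h′ a b →
           P :* h :* h′ :* (Y :* (con (+ 1) :- a :* a) :* (con (+ 1) :- b :* b))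
           := P :* Y :* (con (+ 1) :+ a) :* (con (+ 1) :- b)
              :* (h :* (con (+ 1) :- a)) :* (h′ :* (con (+ 1) :+ b)))
           refl (∏ (dbl n) h) (Y (dbl n)) (h (dbl n)) (h (suc (dbl n))) a b ⟩
    ∏ (dbl n) h * Y (dbl n) * (1# + a) * (1# - b) * (h (dbl n) * (1# - a)) * (h (suc (dbl n)) * (1# + b))
      ≈⟨ *-cong (*-cong (*-congʳ (*-congʳ (∏h*Y n))) (h-even-inverse n)) (h-odd-inverse n) ⟩
    odds n * Y n * (1# + a) * (1# - b) * 1# * 1#
      ≈⟨ solve 4 (λ o y a b → o :* y :* a :* b :* con (+ 1) :* con (+ 1) := o :* a :* (y :* b)) refl _ _ _ _ ⟩
    odds n * (1# + a) * (Y n * (1# - b)) ∎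
    where
    a = q^ suc (dbl n)
    b = q^ (2 ℕ.+ dbl n)

  -- The q²-binomial coefficient of b + c over b.
  binomial : ℕ → ℕ → Carrier
  binomial b c = Y (b ℕ.+ c) * (I b * I c)

  -- By the q²-Pascal rule, which comes from 1 - s t = (1 - s) + s (1 - t).
  binomial≽1 : ∀ b c → binomial b c ≽ 1#
  binomial≽1 zero c = ≽-reflexive (trans
    (solve 2 (λ y i → y :* (con (+ 1) :* i) := i :* y) refl _ _) (I*Y c))
  binomial≽1 (suc b) zero = ≽-reflexive (trans
    (trans (*-congʳ (reflexive (≡.cong Y (ℕ.+-identityʳ (suc b)))))
      (solve 2 (λ y i → y :* (i :* con (+ 1)) := i :* y) refl _ _)) (I*Y (suc b)))
  binomial≽1 (suc b) (suc c) = ≽-resp (sym pascal) refl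
    (+-≽ˡ (binomial≽1 b (suc c)) (NonNeg-* (q^-nonNeg _) (≽1-nonNeg (binomial≽1 (suc b) c))))
    where
    s = q^ (2 ℕ.+ dbl b)
    t = q^ (2 ℕ.+ dbl c)
    k = b ℕ.+ c
    pascal : binomial (suc b) (suc c) ≈ binomial b (suc c) + s * binomial (suc b) c
    pascal = begin
      Y (suc (b ℕ.+ suc c)) * (I (suc b) * I (suc c))
        ≈⟨ *-congʳ (reflexive (≡.cong (λ i → Y (suc i)) (ℕ.+-suc b c))) ⟩
      Y (suc k) * (1# - q^ (2 ℕ.+ dbl (suc k))) * (I (suc b) * I (suc c))
        ≈⟨ *-congʳ (*-congˡ (+-congˡ (-‿cong (sym (q^-*₂ (2 ℕ.+ dbl b) (2 ℕ.+ dbl c)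
             (N.solve 2 (λ b c → N.con 2 N.:+ (b N.:+ b) N.:+ (N.con 2 N.:+ (c N.:+ c))
               N.:= N.con 2 N.:+ (N.con 1 N.:+ (b N.:+ c) N.:+ (N.con 1 N.:+ (b N.:+ c)))) ≡.refl b c)))))) ⟩
      Y (suc k) * (1# - s * t) * (I (suc b) * I (suc c))
        ≈⟨ solve 5 (λ y s t i j → y :* (con (+ 1) :- s :* t) :* (i :* j)
             := y :* ((con (+ 1) :- s) :* i :* j) :+ s :* (y :* (i :* ((con (+ 1) :- t) :* j))))
             refl (Y (suc k)) s t (I (suc b)) (I (suc c)) ⟩
      Y (suc k) * ((1# - s) * I (suc b) * I (suc c)) + s * (Y (suc k) * (I (suc b) * ((1# - t) * I (suc c))))
        ≈⟨ +-cong (*-cong (reflexive (≡.cong Y (≡.sym (ℕ.+-suc b c)))) (*-congʳ (sym (I-step b))))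
             (*-congˡ (*-congˡ (*-congˡ (sym (I-step c))))) ⟩
      Y (b ℕ.+ suc c) * (I b * I (suc c)) + s * (Y (suc b ℕ.+ c) * (I (suc b) * I c)) ∎
      where
      I-step : ∀ c → I c ≈ (1# - q^ (2 ℕ.+ dbl c)) * I (suc c)
      I-step c = trans (J-step (suc c))
        (*-congʳ (reflexive (≡.cong (λ i → 1# - q^ i) (≡.cong suc (ℕ.+-suc c c)))))

  wTerm : ℕ → ℕ → Carrier
  wTerm m n = ∏ (2 ℕ.* n ℕ.+ 1) h * (q^ (2 ℕ.* n) * C n m)

  wSeries : ℕ → Carrier
  wSeries m = ∑ order (wTerm m)

  -- Keeps visible the power of q and the two factors that strictness relies on, 1 / (1 - q^{2n+1})
  -- and (-q;q²)ₘ; all else is hidden in a cofactor that is at least 1.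
  record GapFactorisation (m c : ℕ) : Set where
    n = m ℕ.+ c
    field
      cofactor   : Carrier
      cofactor≽1 : cofactor ≽ 1#
      factorises : wTerm m n - wTerm (suc m) n ≈
        q^ (m ℕ.* m ℕ.+ dbl n) * (g (dbl n) * odds m * cofactor)

  -- The factor 1 - q^{2m+1} of C-gap and the factor 1 + q^{2m+1} of odds (suc n)
  -- together cancel the factor 1 / (1 - q^{2(2m+1)}) of I (suc (n + m)).
  gapFactorisation : ∀ m c → GapFactorisation m c
  gapFactorisation m c = record
    { cofactor = binomial m c * R₁ * R₂ * R₃
    ; cofactor≽1 = *-≽1 (*-≽1 (*-≽1 (binomial≽1 m c) (∏-≽1 m (λ i → g≽1 (suc (dbl (m ℕ.+ i))))))
        (∏-≽1 c (λ i → g≽1 (suc (dbl (dbl m ℕ.+ suc i))))))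
        (∏-≽1 c (λ i → 1+q^≽1 _))
    ; factorises = begin
        wTerm m n - wTerm (suc m) n
          ≈⟨ solve 4 (λ k q a b → k :* (q :* a) :- k :* (q :* b) := k :* q :* (a :- b)) refl
               (∏ (2 ℕ.* n ℕ.+ 1) h) (q^ (2 ℕ.* n)) (C n m) (C n (suc m)) ⟩
        ∏ (2 ℕ.* n ℕ.+ 1) h * q^ (2 ℕ.* n) * (C n m - C n (suc m))
          ≈⟨ *-cong (*-cong
               (trans (reflexive (≡.cong (λ i → ∏ i h) (N.solve 1 (λ n → N.con 2 N.:* n N.:+ N.con 1
                  N.:= N.con 1 N.:+ (n N.:+ n)) ≡.refl n))) (*-congˡ (h-even n)))
               (congᵉ (≡.cong (n ℕ.+_) (ℕ.+-identityʳ n))))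
             (C-gap m c) ⟩
        ∏ (dbl n) h * g (dbl n) * q^ dbl n
          * (q^ (m ℕ.* m) * Y (dbl n) * (I c * I (suc (n ℕ.+ m))) * (1# - r) * (1# + q^ suc (dbl n)))
          ≈⟨ solve 9 (λ H G q Q Y i j r s → H :* G :* q :* (Q :* Y :* (i :* j) :* r :* s)
               := Q :* q :* (G :* (H :* Y :* s) :* (i :* j) :* r)) refl _ _ _ _ _ _ _ _ _ ⟩
        q^ (m ℕ.* m) * q^ dbl n
          * (g (dbl n) * (∏ (dbl n) h * Y (dbl n) * (1# + q^ suc (dbl n)))
            * (I c * I (suc (n ℕ.+ m))) * (1# - r))
          ≈⟨ *-cong (q^-*₂ (m ℕ.* m) (dbl n) ≡.refl)
               (*-congʳ (*-cong (*-congˡ odds-split) (*-congˡ I-split))) ⟩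
        q^ (m ℕ.* m ℕ.+ dbl n)
          * (g (dbl n) * (odds m * ((1# + r) * R₃) * Y n) * (I c * (I m * R₁ * (g₄ * R₂))) * (1# - r))
          ≈⟨ *-congˡ (solve 10 (λ G o r R₃ Y i j R₁ g₄ R₂ →
               G :* (o :* ((con (+ 1) :+ r) :* R₃) :* Y) :* (i :* (j :* R₁ :* (g₄ :* R₂))) :* (con (+ 1) :- r)
               := g₄ :* (con (+ 1) :- r :* r) :* (G :* o :* (Y :* (j :* i) :* R₁ :* R₂ :* R₃)))
               refl (g (dbl n)) (odds m) r R₃ (Y n) (I c) (I m) R₁ g₄ R₂) ⟩
        q^ (m ℕ.* m ℕ.+ dbl n)
          * (g₄ * (1# - r * r) * (g (dbl n) * odds m * (binomial m c * R₁ * R₂ * R₃)))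
          ≈⟨ *-congˡ (trans (*-congʳ cancel) (*-identityˡ _)) ⟩
        q^ (m ℕ.* m ℕ.+ dbl n) * (g (dbl n) * odds m * (binomial m c * R₁ * R₂ * R₃)) ∎
    }
    where
    n = m ℕ.+ c
    r = q^ suc (dbl m)
    g₄ = g (suc (dbl (dbl m)))
    -- `R₁` and `R₂` collect the factors of `I (suc (n + m))` with index from m to 2m - 1 and above
    -- 2m; `R₃` those of `odds (suc n)` with index above m. The factors `I m`, `I c` and `Y n` form
    -- the binomial coefficient.
    R₁ = ∏ m (λ i → g (suc (dbl (m ℕ.+ i))))
    R₂ = ∏ c (λ i → g (suc (dbl (dbl m ℕ.+ suc i))))
    R₃ = ∏ c (λ i → 1# + q^ suc (dbl (m ℕ.+ suc i)))
    cancel : g₄ * (1# - r * r) ≈ 1#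
    cancel = trans (*-congˡ (+-congˡ (-‿cong (q^-*₂ (suc (dbl m)) (suc (dbl m))
      (≡.cong suc (ℕ.+-suc _ _)))))) (g-inverse (suc (dbl (dbl m))))
    odds-split : ∏ (dbl n) h * Y (dbl n) * (1# + q^ suc (dbl n)) ≈ odds m * ((1# + r) * R₃) * Y n
    odds-split = begin
      ∏ (dbl n) h * Y (dbl n) * (1# + q^ suc (dbl n)) ≈⟨ *-congʳ (∏h*Y n) ⟩
      odds n * Y n * (1# + q^ suc (dbl n))
        ≈⟨ solve 3 (λ a b c → a :* b :* c := a :* c :* b) refl _ _ _ ⟩
      odds (suc n) * Y n
        ≈⟨ *-congʳ (trans (reflexive (≡.cong odds (≡.sym (ℕ.+-suc m c)))) (∏-first m c _)) ⟩
      odds m * ((1# + r) * R₃) * Y n ∎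
    I-split : I (suc (n ℕ.+ m)) ≈ I m * R₁ * (g₄ * R₂)
    I-split = trans (reflexive (≡.cong I (N.solve 2 (λ m c → N.con 1 N.:+ (m N.:+ c N.:+ m)
        N.:= m N.:+ m N.:+ (N.con 1 N.:+ c)) ≡.refl m c)))
      (trans (∏-first (dbl m) c _) (*-congʳ (∏-split m m _)))

  -- Strict gaps and vanishing for w

  odds≽1 : ∀ m → odds m ≽ 1#
  odds≽1 m = ∏-≽1 m (λ i → 1+q^≽1 _)

  odds≽q : ∀ m → odds (suc m) ≽ q^ 1
  odds≽q zero = ≽-resp (sym (*-identityˡ _)) refl
    (≽-resp (+-comm _ _) refl (+-≽ˡ (≽-reflexive refl) 1-nonNeg))
  odds≽q (suc m) = *-≽ˡ (≽1-nonNeg (odds≽1 (suc m))) (odds≽q m) (1+q^≽1 _)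

  module _ (m c : ℕ) where
    open GapFactorisation (gapFactorisation m c)

    wTerm-gap≽ : ∀ e → g (dbl n) * odds m ≽ q^ e →
      wTerm m n - wTerm (suc m) n ≽ q^ (m ℕ.* m ℕ.+ dbl n ℕ.+ e)
    wTerm-gap≽ e p = ≽-resp (sym factorises) (sym (q^-+ _ e))
      (*-mono-≽ (q^-nonNeg _) (q^-nonNeg e) (≽-reflexive refl)
        (*-≽ˡ (NonNeg-* (g-nonNeg (dbl n)) (≽1-nonNeg (odds≽1 m))) p cofactor≽1))

    wTerm-gap≽even : wTerm m n - wTerm (suc m) n ≽ q^ (m ℕ.* m ℕ.+ dbl n ℕ.+ 0)
    wTerm-gap≽even = wTerm-gap≽ 0 (≽-resp refl (sym q^-zero) (*-≽1 (g≽1 (dbl n)) (odds≽1 m)))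

  wTerm-gap-nonNeg : ∀ m n → wTerm m n ≽ wTerm (suc m) n
  wTerm-gap-nonNeg m n with m ℕ.≤? n
  ... | yes m≤n = ≡.subst (λ n → wTerm m n ≽ wTerm (suc m) n) (ℕ.m+[n∸m]≡n m≤n)
                    (≽-nonNeg (wTerm-gap≽even m (n ℕ.∸ m)) (q^-nonNeg _))
  ... | no m≰n = ≽-reflexive (*-congˡ (*-congˡ (trans (C-vanish n m (ℕ.≰⇒> m≰n))
                    (sym (C-vanish n (suc m) (ℕ.m≤n⇒m≤1+n (ℕ.≰⇒> m≰n)))))))

  wSeries-decreasing : ∀ m → wSeries m ≽ wSeries (suc m)
  wSeries-decreasing m = NonNeg-resp (sym (∑-- order _ _)) (∑-nonNeg order (wTerm-gap-nonNeg m))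

  wSeries-gap≽term : ∀ m n {e} → n ≤ order → wTerm m n - wTerm (suc m) n ≽ e →
    wSeries m - wSeries (suc m) ≽ e
  wSeries-gap≽term m n p r = ≽-resp (sym (∑-- order _ _)) refl
    (≽-trans (∑-≽-term {f = λ n → wTerm m n - wTerm (suc m) n} (wTerm-gap-nonNeg m) p) r)

  parity : ∀ k → ∃[ c ] (k ≡ dbl c ⊎ k ≡ suc (dbl c))
  parity zero = 0 , inj₁ ≡.refl
  parity (suc k) with parity k
  ... | c , inj₁ p = c , inj₂ (≡.cong suc p)
  ... | c , inj₂ p = suc c , inj₁ (≡.cong suc (≡.trans p (≡.sym (ℕ.+-suc c c))))

  -- `c` selects the summand n = m + c, and `e` is the exponent drawn from `g` and `odds` so that
  -- the total is exactly `order`.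
  wSeries-gap-at : ∀ m c e → m ℕ.* m ℕ.+ dbl (m ℕ.+ c) ℕ.+ e ≡ order →
    g (dbl (m ℕ.+ c)) * odds m ≽ q^ e → wSeries m - wSeries (suc m) ≽ q^ order
  wSeries-gap-at m c e p r = wSeries-gap≽term m n
    (≡.subst (n ≤_) p (ℕ.≤-trans (ℕ.m≤m+n n n) (ℕ.≤-trans (ℕ.m≤n+m (dbl n) (m ℕ.* m)) (ℕ.m≤m+n _ e))))
    (≽-resp refl (congᵉ p) (wTerm-gap≽ m c e r))
    where n = m ℕ.+ c

  -- The leading exponents m² + 2n for n ≥ m have a single parity; the factor 1 + q of `odds m`
  -- reaches the other. For m = 0 that product is empty, and 1 / (1 - q) in the summand n = 0 yields
  -- every exponent.
  wSeries-gap : ∀ m → m ℕ.* m ℕ.+ dbl m ≤ order → wSeries m - wSeries (suc m) ≽ q^ order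
  wSeries-gap zero p = wSeries-gap-at 0 0 order ≡.refl
    (≽-resp (sym (*-identityʳ _)) refl (g₀≽q^ order))
  wSeries-gap (suc m) p with parity (order ℕ.∸ (suc m ℕ.* suc m ℕ.+ dbl (suc m)))
  ... | c , e = go e
    where
    lower = suc m ℕ.* suc m ℕ.+ dbl (suc m)
    exponent : ∀ i → order ℕ.∸ lower ≡ i ℕ.+ dbl c →
      suc m ℕ.* suc m ℕ.+ dbl (suc m ℕ.+ c) ℕ.+ i ≡ order
    exponent i q = ≡.trans
      (N.solve 3 (λ m c i → let s = N.con 1 N.:+ m in
        s N.:* s N.:+ (s N.:+ c N.:+ (s N.:+ c)) N.:+ i
        N.:= s N.:* s N.:+ (s N.:+ s) N.:+ (i N.:+ (c N.:+ c))) ≡.refl m c i)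
      (≡.trans (≡.cong (lower ℕ.+_) (≡.sym q)) (ℕ.m+[n∸m]≡n p))
    go : order ℕ.∸ lower ≡ dbl c ⊎ order ℕ.∸ lower ≡ suc (dbl c) →
      wSeries (suc m) - wSeries (suc (suc m)) ≽ q^ order
    go (inj₁ q) = wSeries-gap-at (suc m) c 0 (exponent 0 q)
      (≽-resp refl (sym q^-zero) (*-≽1 (g≽1 (dbl (suc m ℕ.+ c))) (odds≽1 (suc m))))
    go (inj₂ q) = wSeries-gap-at (suc m) c 1 (exponent 1 q)
      (*-≽ʳ (g≽1 (dbl (suc m ℕ.+ c))) (q^-nonNeg 1) (odds≽q m))

  -- Summands with n < m vanish; for n ≥ m the closed form shows divisibility by q^{2n + m²}.
  wSeries-vanish : ∀ m → order < m ℕ.* m ℕ.+ dbl m → wSeries m ≈ 0#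
  wSeries-vanish m p = ∑-zero order term-vanish
    where
    term-vanish : ∀ n → wTerm m n ≈ 0#
    term-vanish n with m ℕ.≤? n
    ... | no m≰n = trans (*-congˡ (trans (*-congˡ (C-vanish n m (ℕ.≰⇒> m≰n))) (zeroʳ _))) (zeroʳ _)
    ... | yes m≤n = begin
      ∏ (2 ℕ.* n ℕ.+ 1) h * (q^ (2 ℕ.* n) * C n m)
        ≈⟨ *-congˡ (*-congˡ (C-closed n m (suc (n ℕ.∸ m))
             (≡.trans (ℕ.+-suc m _) (≡.cong suc (ℕ.m+[n∸m]≡n m≤n))))) ⟩
      ∏ (2 ℕ.* n ℕ.+ 1) h * (q^ (2 ℕ.* n) * (q^ (m ℕ.* m) * _))
        ≈⟨ *-congˡ (trans (sym (*-assoc _ _ _)) (*-congʳ (trans (q^-*₂ (2 ℕ.* n) (m ℕ.* m) ≡.refl)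
             (q^-vanish (ℕ.<-≤-trans p bound))))) ⟩
      ∏ (2 ℕ.* n ℕ.+ 1) h * (0# * _) ≈⟨ trans (*-congˡ (zeroˡ _)) (zeroʳ _) ⟩
      0# ∎
      where
      bound : m ℕ.* m ℕ.+ dbl m ≤ 2 ℕ.* n ℕ.+ m ℕ.* m
      bound = ℕ.≤-trans (ℕ.≤-reflexive (ℕ.+-comm (m ℕ.* m) (dbl m)))
        (ℕ.+-monoˡ-≤ (m ℕ.* m) (ℕ.≤-trans (ℕ.+-mono-≤ m≤n m≤n)
          (ℕ.≤-reflexive (≡.cong (n ℕ.+_) (≡.sym (ℕ.+-identityʳ n))))))

-- Integer power series under the Cauchy product

Series : Set
Series = ℕ → ℤ

module PowerSeries where
  open import Data.Nat using (_≤_; _<_)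
  open import Data.Integer using (_+_; _*_)
  open I using (solve; _:=_; _:+_; _:*_; con)
  open ≡.≡-Reasoning

  infixl 7 _⊛_
  -- The Cauchy product, splitting off the constant term of the left factor: `f ∘ suc` stands for (f
  -- - f 0) / q.
  _⊛_ : Series → Series → Series
  (f ⊛ g) zero = f 0 * g 0
  (f ⊛ g) (suc n) = f 0 * g (suc n) + (f ∘ suc ⊛ g) n

  infixl 6 _⊞_
  _⊞_ : Series → Series → Series
  (f ⊞ g) n = f n + g n

  infixl 8 _•_
  _•_ : ℤ → Series → Series
  (c • f) n = c * f n

  const : ℤ → Series
  const c zero = c
  const c (suc n) = + 0

  monomial : ℕ → Series
  monomial zero = const (+ 1)
  monomial (suc e) zero = + 0
  monomial (suc e) (suc n) = monomial e n

  -- Coefficient n of a product involves only coefficients up to n, so equality up to a fixed degree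
  -- is a ring congruence.
  ⊛-cong-≤ : ∀ {f f′ g g′} n → (∀ i → i ≤ n → f i ≡ f′ i) → (∀ i → i ≤ n → g i ≡ g′ i) →
    (f ⊛ g) n ≡ (f′ ⊛ g′) n
  ⊛-cong-≤ zero p r = ≡.cong₂ _*_ (p 0 z≤n) (r 0 z≤n)
  ⊛-cong-≤ (suc n) p r = ≡.cong₂ _+_ (≡.cong₂ _*_ (p 0 z≤n) (r (suc n) ℕ.≤-refl))
    (⊛-cong-≤ n (λ i i≤n → p (suc i) (s≤s i≤n)) (λ i i≤n → r i (ℕ.m≤n⇒m≤1+n i≤n)))

  ⊛-distribʳ : ∀ h f g → (f ⊞ g) ⊛ h ≗ (f ⊛ h) ⊞ (g ⊛ h)
  ⊛-distribʳ h f g zero = ℤ.*-distribʳ-+ (h 0) (f 0) (g 0)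
  ⊛-distribʳ h f g (suc n) = ≡.trans
    (≡.cong (_+_ ((f 0 + g 0) * h (suc n))) (⊛-distribʳ h (f ∘ suc) (g ∘ suc) n))
    (solve 5 (λ f g h a b → (f :+ g) :* h :+ (a :+ b) := f :* h :+ a :+ (g :* h :+ b)) ≡.refl
      (f 0) (g 0) (h (suc n)) ((f ∘ suc ⊛ h) n) ((g ∘ suc ⊛ h) n))

  •-⊛ : ∀ c f g → c • f ⊛ g ≗ c • (f ⊛ g)
  •-⊛ c f g zero = ℤ.*-assoc c (f 0) (g 0)
  •-⊛ c f g (suc n) = ≡.trans (≡.cong (_+_ (c * f 0 * g (suc n))) (•-⊛ c (f ∘ suc) g n))
    (solve 4 (λ c f g a → c :* f :* g :+ c :* a := c :* (f :* g :+ a)) ≡.refl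
      c (f 0) (g (suc n)) ((f ∘ suc ⊛ g) n))

  -- The mirror image of the defining recursion; commutativity rests on it.
  ⊛-sucʳ : ∀ f g n → (f ⊛ g) (suc n) ≡ f (suc n) * g 0 + (f ⊛ g ∘ suc) n
  ⊛-sucʳ f g zero = ℤ.+-comm (f 0 * g 1) (f 1 * g 0)
  ⊛-sucʳ f g (suc n) = ≡.trans (≡.cong (_+_ (f 0 * g (suc (suc n)))) (⊛-sucʳ (f ∘ suc) g n))
    (solve 3 (λ a b c → a :+ (b :+ c) := b :+ (a :+ c)) ≡.refl
      (f 0 * g (suc (suc n))) (f (suc (suc n)) * g 0) ((f ∘ suc ⊛ g ∘ suc) n))

  ⊛-comm : ∀ f g → f ⊛ g ≗ g ⊛ f
  ⊛-comm f g zero = ℤ.*-comm (f 0) (g 0)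
  ⊛-comm f g (suc n) = ≡.trans (⊛-sucʳ f g n)
    (≡.cong₂ _+_ (ℤ.*-comm (f (suc n)) (g 0)) (⊛-comm f (g ∘ suc) n))

  ⊛-assoc : ∀ f g h → (f ⊛ g) ⊛ h ≗ f ⊛ (g ⊛ h)
  ⊛-assoc f g h zero = ℤ.*-assoc (f 0) (g 0) (h 0)
  ⊛-assoc f g h (suc n) = begin
    f 0 * g 0 * h (suc n) + ((f 0 • (g ∘ suc) ⊞ (f ∘ suc ⊛ g)) ⊛ h) n
      ≡⟨ ≡.cong (_+_ (f 0 * g 0 * h (suc n))) (≡.trans (⊛-distribʳ h (f 0 • (g ∘ suc)) (f ∘ suc ⊛ g) n)
           (≡.cong₂ _+_ (•-⊛ (f 0) (g ∘ suc) h n) (⊛-assoc (f ∘ suc) g h n))) ⟩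
    f 0 * g 0 * h (suc n) + (f 0 * (g ∘ suc ⊛ h) n + (f ∘ suc ⊛ (g ⊛ h)) n)
      ≡⟨ solve 5 (λ f g h a b → f :* g :* h :+ (f :* a :+ b) := f :* (g :* h :+ a) :+ b) ≡.refl
           (f 0) (g 0) (h (suc n)) ((g ∘ suc ⊛ h) n) ((f ∘ suc ⊛ (g ⊛ h)) n) ⟩
    f 0 * (g 0 * h (suc n) + (g ∘ suc ⊛ h) n) + (f ∘ suc ⊛ (g ⊛ h)) n ∎

  0-⊛ : ∀ f n → ((λ _ → + 0) ⊛ f) n ≡ + 0
  0-⊛ f zero = ≡.refl
  0-⊛ f (suc n) = ≡.trans (ℤ.+-identityˡ _) (0-⊛ f n)

  const-⊛ : ∀ c f → const c ⊛ f ≗ c • f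
  const-⊛ c f zero = ≡.refl
  const-⊛ c f (suc n) = ≡.trans (≡.cong (_+_ (c * f (suc n))) (0-⊛ f n)) (ℤ.+-identityʳ _)

  1-⊛ : ∀ f → const (+ 1) ⊛ f ≗ f
  1-⊛ f n = ≡.trans (const-⊛ (+ 1) f n) (ℤ.*-identityˡ _)

  monomial-+ : ∀ a b → monomial (a ℕ.+ b) ≗ monomial a ⊛ monomial b
  monomial-+ zero b n = ≡.sym (1-⊛ (monomial b) n)
  monomial-+ (suc a) b zero = ≡.refl
  monomial-+ (suc a) b (suc n) = ≡.trans (monomial-+ a b n) (≡.sym (ℤ.+-identityˡ _))

  monomial-nonNeg : ∀ e n → + 0 ℤ.≤ monomial e n
  monomial-nonNeg zero zero = ℤ.+≤+ z≤n
  monomial-nonNeg zero (suc n) = ℤ.≤-refl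
  monomial-nonNeg (suc e) zero = ℤ.≤-refl
  monomial-nonNeg (suc e) (suc n) = monomial-nonNeg e n

  monomial-vanish : ∀ {e n} → n < e → monomial e n ≡ + 0
  monomial-vanish {suc e} {zero} p = ≡.refl
  monomial-vanish {suc e} {suc n} (s≤s p) = monomial-vanish p

  monomial-diagonal : ∀ e → monomial e e ≡ + 1
  monomial-diagonal zero = ≡.refl
  monomial-diagonal (suc e) = monomial-diagonal e

  *-nonNeg : ∀ {i j} → + 0 ℤ.≤ i → + 0 ℤ.≤ j → + 0 ℤ.≤ i * j
  *-nonNeg {i} {j} p r = ≡.subst (ℤ._≤ i * j) (ℤ.*-zeroʳ i)
    (ℤ.*-monoˡ-≤-nonNeg i {{ℤ.nonNegative p}} r)

  ⊛-nonNeg : ∀ {f g} n → (∀ i → i ≤ n → + 0 ℤ.≤ f i) → (∀ i → i ≤ n → + 0 ℤ.≤ g i) →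
    + 0 ℤ.≤ (f ⊛ g) n
  ⊛-nonNeg zero p r = *-nonNeg (p 0 z≤n) (r 0 z≤n)
  ⊛-nonNeg (suc n) p r = ℤ.+-mono-≤ (*-nonNeg (p 0 z≤n) (r (suc n) ℕ.≤-refl))
    (⊛-nonNeg n (λ i i≤n → p (suc i) (s≤s i≤n)) (λ i i≤n → r i (ℕ.m≤n⇒m≤1+n i≤n)))

open PowerSeries

-- Integer power series up to degree N as a model of the axioms

module UpTo (N : ℕ) where
  open import Data.Nat using (_≤_; _<_)

  infix 4 _≈_
  record _≈_ (f g : Series) : Set where
    constructor upTo
    field at : ∀ n → n ≤ N → f n ≡ g n
  open _≈_ public

  record NonNeg (f : Series) : Set where
    constructor upTo
    field at : ∀ n → n ≤ N → + 0 ℤ.≤ f n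

  pointwise : ∀ {f g} → f ≗ g → f ≈ g
  pointwise p = upTo (λ n _ → p n)

  commutativeRing : CommutativeRing 0ℓ 0ℓ
  commutativeRing = record
    { Carrier = Series
    ; _≈_ = _≈_
    ; _+_ = _⊞_
    ; _*_ = _⊛_
    ; -_ = λ f n → ℤ.- f n
    ; 0# = λ _ → + 0
    ; 1# = const (+ 1)
    ; isCommutativeRing = record
      { isRing = record
        { +-isAbelianGroup = record
          { isGroup = record
            { isMonoid = record
              { isSemigroup = record
                { isMagma = record
                  { isEquivalence = record
                    { refl = pointwise (λ _ → ≡.refl)
                    ; sym = λ p → upTo (λ n n≤ → ≡.sym (at p n n≤))
                    ; trans = λ p r → upTo (λ n n≤ → ≡.trans (at p n n≤) (at r n n≤))
                    }
                  ; ∙-cong = λ p r → upTo (λ n n≤ → ≡.cong₂ ℤ._+_ (at p n n≤) (at r n n≤))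
                  }
                ; assoc = λ f g h → pointwise (λ n → ℤ.+-assoc (f n) (g n) (h n))
                }
              ; identity = (λ f → pointwise (λ n → ℤ.+-identityˡ (f n)))
                         , (λ f → pointwise (λ n → ℤ.+-identityʳ (f n)))
              }
            ; inverse = (λ f → pointwise (λ n → ℤ.+-inverseˡ (f n)))
                      , (λ f → pointwise (λ n → ℤ.+-inverseʳ (f n)))
            ; ⁻¹-cong = λ p → upTo (λ n n≤ → ≡.cong ℤ.-_ (at p n n≤))
            }
          ; comm = λ f g → pointwise (λ n → ℤ.+-comm (f n) (g n))
          }
        ; *-cong = λ p r → upTo (λ n n≤ → ⊛-cong-≤ n
            (λ i i≤n → at p i (ℕ.≤-trans i≤n n≤)) (λ i i≤n → at r i (ℕ.≤-trans i≤n n≤)))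
        ; *-assoc = λ f g h → pointwise (⊛-assoc f g h)
        ; *-identity = (λ f → pointwise (1-⊛ f))
                     , (λ f → pointwise (λ n → ≡.trans (⊛-comm f (const (+ 1)) n) (1-⊛ f n)))
        ; distrib = (λ h f g → pointwise (λ n → ≡.trans (⊛-comm h (f ⊞ g) n)
                      (≡.trans (⊛-distribʳ h f g n) (≡.cong₂ ℤ._+_ (⊛-comm f h n) (⊛-comm g h n)))))
                  , (λ h f g → pointwise (⊛-distribʳ h f g))
        }
      ; *-comm = λ f g → pointwise (⊛-comm f g)
      }
    }

  truncatedSeries : TruncatedSeries
  truncatedSeries = record
    { commutativeRing = commutativeRing
    ; scalars = record
      { ⟦_⟧ = const
      ; +-homo = λ i j → pointwise λ { zero → ≡.refl ; (suc n) → ≡.refl }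
      ; *-homo = λ i j → pointwise λ
          { zero → ≡.refl
          ; (suc n) → ≡.sym (≡.trans (const-⊛ i (const j) (suc n)) (ℤ.*-zeroʳ i)) }
      ; -‿homo = λ i → pointwise λ { zero → ≡.refl ; (suc n) → ≡.refl }
      ; 0-homo = pointwise λ { zero → ≡.refl ; (suc n) → ≡.refl }
      ; 1-homo = pointwise λ _ → ≡.refl
      }
    ; NonNeg = NonNeg
    ; NonNeg-resp = λ p r → upTo (λ n n≤ → ≡.subst (+ 0 ℤ.≤_) (at p n n≤) (NonNeg.at r n n≤))
    ; NonNeg-+ = λ p r → upTo (λ n n≤ → ℤ.+-mono-≤ (NonNeg.at p n n≤) (NonNeg.at r n n≤))
    ; NonNeg-* = λ p r → upTo (λ n n≤ → ⊛-nonNeg n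
        (λ i i≤n → NonNeg.at p i (ℕ.≤-trans i≤n n≤)) (λ i i≤n → NonNeg.at r i (ℕ.≤-trans i≤n n≤)))
    ; q^_ = monomial
    ; q^-zero = pointwise λ _ → ≡.refl
    ; q^-+ = λ a b → pointwise (monomial-+ a b)
    ; q^-nonNeg = λ e → upTo (λ n _ → monomial-nonNeg e n)
    ; order = N
    ; q^-vanish = λ p → upTo (λ n n≤ → monomial-vanish (ℕ.≤-<-trans n≤ p))
    }

-- Formal polynomials as a commutative semigroup under multiplication

module ℤ+ = Algebra.Properties.Group (AbelianGroup.group ℤ.+-0-abelianGroup)

mulTerm : Term → Term → Term
mulTerm (m , n , c) (m′ , n′ , c′) = m ℤ.+ m′ , n ℕ.+ n′ , c ℤ.* c′

mulTerm-comm : ∀ s t → mulTerm s t ≡ mulTerm t s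
mulTerm-comm (m , n , c) (m′ , n′ , c′) =
  ≡.cong₂ _,_ (ℤ.+-comm m m′) (≡.cong₂ _,_ (ℕ.+-comm n n′) (ℤ.*-comm c c′))

mulTerm-assoc : ∀ s t u → mulTerm (mulTerm s t) u ≡ mulTerm s (mulTerm t u)
mulTerm-assoc (m , n , c) (m′ , n′ , c′) (m″ , n″ , c″) =
  ≡.cong₂ _,_ (ℤ.+-assoc m m′ m″) (≡.cong₂ _,_ (ℕ.+-assoc n n′ n″) (ℤ.*-assoc c c′ c″))

map-⊗ : ∀ t r s → map (mulTerm t) r ⊗ s ≡ map (mulTerm t) (r ⊗ s)
map-⊗ t [] s = ≡.refl
map-⊗ t (u ∷ r) s = ≡.trans
  (≡.cong₂ _++_ (≡.trans (map-cong (mulTerm-assoc t u) s) (map-∘ s)) (map-⊗ t r s))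
  (≡.sym (map-++ (mulTerm t) (map (mulTerm u) s) (r ⊗ s)))

++-⊗ : ∀ p r s → (p ++ r) ⊗ s ≡ (p ⊗ s) ++ (r ⊗ s)
++-⊗ [] r s = ≡.refl
++-⊗ (t ∷ p) r s = ≡.trans (≡.cong (map (mulTerm t) s ++_) (++-⊗ p r s))
  (≡.sym (++-assoc (map (mulTerm t) s) (p ⊗ s) (r ⊗ s)))

-- Holds for the lists of terms themselves, whereas commutativity holds only for coefficients.
⊗-assoc : ∀ p r s → (p ⊗ r) ⊗ s ≡ p ⊗ (r ⊗ s)
⊗-assoc [] r s = ≡.refl
⊗-assoc (t ∷ p) r s = ≡.trans (++-⊗ (map (mulTerm t) r) (p ⊗ r) s)
  (≡.cong₂ _++_ (map-⊗ t r s) (⊗-assoc p r s))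

coefficientSeries : Poly → ℤ → Series
coefficientSeries p m n = coeff m n p

coeff-++ : ∀ m n p r → coeff m n (p ++ r) ≡ coeff m n p ℤ.+ coeff m n r
coeff-++ m n [] r = ≡.sym (ℤ.+-identityˡ _)
coeff-++ m n ((m′ , n′ , c) ∷ p) r = ≡.trans (≡.cong (ℤ._+_ t) (coeff-++ m n p r))
  (≡.sym (ℤ.+-assoc t (coeff m n p) (coeff m n r)))
  where t = if ⌊ m ℤ.≟ m′ ⌋ ∧ ⌊ n ℕ.≟ n′ ⌋ then c else + 0

⌊≟⌋-shift : ∀ d m m′ → ⌊ d ℤ.+ m ℤ.≟ d ℤ.+ m′ ⌋ ≡ ⌊ m ℤ.≟ m′ ⌋
⌊≟⌋-shift d m m′ = ≡.trans (isYes≗does _) (≡.trans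
  (does-⇔ (mk⇔ (ℤ+.∙-cancelˡ d m m′) (≡.cong (ℤ._+_ d))) (d ℤ.+ m ℤ.≟ d ℤ.+ m′) (m ℤ.≟ m′))
  (≡.sym (isYes≗does _)))

⌊≟⌋-suc : ∀ m n → ⌊ suc m ℕ.≟ suc n ⌋ ≡ ⌊ m ℕ.≟ n ⌋
⌊≟⌋-suc m n = ≡.trans (isYes≗does (suc m ℕ.≟ suc n)) (≡.sym (isYes≗does (m ℕ.≟ n)))

-- The product of the terms c q^e and c′ q^{n′}, where `b` tells whether the exponents of x agree.
if-•-monomial : ∀ b e n′ c c′ n →
  (if b ∧ ⌊ n ℕ.≟ e ℕ.+ n′ ⌋ then c ℤ.* c′ else + 0)
    ≡ (c • monomial e ⊛ λ n → if b ∧ ⌊ n ℕ.≟ n′ ⌋ then c′ else + 0) n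
if-•-monomial b e n′ c c′ n = ≡.trans (go e n) (≡.sym (•-⊛ c (monomial e) _ n))
  where
  f : Series
  f n = if b ∧ ⌊ n ℕ.≟ n′ ⌋ then c′ else + 0
  if-* : ∀ b → (if b then c ℤ.* c′ else + 0) ≡ c ℤ.* (if b then c′ else + 0)
  if-* true = ≡.refl
  if-* false = ≡.sym (ℤ.*-zeroʳ c)
  if-false : ∀ b → (if b ∧ false then c ℤ.* c′ else + 0) ≡ c ℤ.* + 0
  if-false true = ≡.sym (ℤ.*-zeroʳ c)
  if-false false = ≡.sym (ℤ.*-zeroʳ c)
  go : ∀ e n → (if b ∧ ⌊ n ℕ.≟ e ℕ.+ n′ ⌋ then c ℤ.* c′ else + 0) ≡ c ℤ.* (monomial e ⊛ f) n
  go zero n = ≡.trans (if-* (b ∧ ⌊ n ℕ.≟ n′ ⌋)) (≡.cong (ℤ._*_ c) (≡.sym (1-⊛ f n)))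
  go (suc e) zero = if-false b
  go (suc e) (suc n) = ≡.trans (≡.cong (λ d → if b ∧ d then c ℤ.* c′ else + 0) (⌊≟⌋-suc n (e ℕ.+ n′)))
    (≡.trans (go e n) (≡.cong (ℤ._*_ c) (≡.sym (ℤ.+-identityˡ _))))

-- The bridge from lists to series: a term c x^d q^e shifts the index of x by d and multiplies by
-- the series c q^e.
coeff-map-mulTerm : ∀ d e c m n r →
  coeff (d ℤ.+ m) n (map (mulTerm (d , e , c)) r) ≡ (c • monomial e ⊛ coefficientSeries r m) n
coeff-map-mulTerm d e c m n [] = ≡.sym
  (≡.trans (⊛-comm (c • monomial e) _ n) (0-⊛ (c • monomial e) n))
coeff-map-mulTerm d e c m n ((m′ , n′ , c′) ∷ r) = begin
  (if ⌊ d ℤ.+ m ℤ.≟ d ℤ.+ m′ ⌋ ∧ ⌊ n ℕ.≟ e ℕ.+ n′ ⌋ then c ℤ.* c′ else + 0)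
    ℤ.+ coeff (d ℤ.+ m) n (map (mulTerm (d , e , c)) r)
    ≡⟨ ≡.cong₂ ℤ._+_
         (≡.trans (≡.cong (λ b → if b ∧ ⌊ n ℕ.≟ e ℕ.+ n′ ⌋ then c ℤ.* c′ else + 0) (⌊≟⌋-shift d m m′))
           (if-•-monomial ⌊ m ℤ.≟ m′ ⌋ e n′ c c′ n))
         (coeff-map-mulTerm d e c m n r) ⟩
  (M ⊛ t) n ℤ.+ (M ⊛ s) n ≡⟨ ≡.cong₂ ℤ._+_ (⊛-comm M t n) (⊛-comm M s n) ⟩
  (t ⊛ M) n ℤ.+ (s ⊛ M) n ≡⟨ ⊛-distribʳ M t s n ⟨
  ((t ⊞ s) ⊛ M) n ≡⟨ ⊛-comm M (t ⊞ s) n ⟨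
  (M ⊛ (t ⊞ s)) n ∎
  where
  open ≡.≡-Reasoning
  M t s : Series
  M = c • monomial e
  t n = if ⌊ m ℤ.≟ m′ ⌋ ∧ ⌊ n ℕ.≟ n′ ⌋ then c′ else + 0
  s = coefficientSeries r m

infix 4 _≋_
record _≋_ (p r : Poly) : Set where
  constructor equal
  field coeff-≡ : ∀ m n → coeff m n p ≡ coeff m n r
open _≋_

⊗-[] : ∀ p → p ⊗ [] ≡ []
⊗-[] [] = ≡.refl
⊗-[] (t ∷ p) = ⊗-[] p

⊗-∷ : ∀ r t p m n → coeff m n (r ⊗ (t ∷ p)) ≡ coeff m n (map (mulTerm t) r) ℤ.+ coeff m n (r ⊗ p)
⊗-∷ [] t p m n = ≡.refl
⊗-∷ (s ∷ r) t p m n = begin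
  coeff m n (mulTerm s t ∷ (map (mulTerm s) p ++ (r ⊗ (t ∷ p))))
    ≡⟨ coeff-++ m n (mulTerm s t ∷ []) (map (mulTerm s) p ++ (r ⊗ (t ∷ p))) ⟩
  coeff m n (mulTerm s t ∷ []) ℤ.+ coeff m n (map (mulTerm s) p ++ (r ⊗ (t ∷ p)))
    ≡⟨ ≡.cong₂ ℤ._+_ (≡.cong (λ u → coeff m n (u ∷ [])) (mulTerm-comm s t))
         (≡.trans (coeff-++ m n (map (mulTerm s) p) (r ⊗ (t ∷ p)))
           (≡.cong (ℤ._+_ (coeff m n (map (mulTerm s) p))) (⊗-∷ r t p m n))) ⟩
  coeff m n (mulTerm t s ∷ []) ℤ.+
    (coeff m n (map (mulTerm s) p) ℤ.+ (coeff m n (map (mulTerm t) r) ℤ.+ coeff m n (r ⊗ p)))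
    ≡⟨ I.solve 4 (λ a b c d → a I.:+ (b I.:+ (c I.:+ d)) I.:= a I.:+ c I.:+ (b I.:+ d)) ≡.refl
         (coeff m n (mulTerm t s ∷ [])) (coeff m n (map (mulTerm s) p))
         (coeff m n (map (mulTerm t) r)) (coeff m n (r ⊗ p)) ⟩
  coeff m n (mulTerm t s ∷ []) ℤ.+ coeff m n (map (mulTerm t) r) ℤ.+
    (coeff m n (map (mulTerm s) p) ℤ.+ coeff m n (r ⊗ p))
    ≡⟨ ≡.cong₂ ℤ._+_ (≡.sym (coeff-++ m n (mulTerm t s ∷ []) (map (mulTerm t) r)))
         (≡.sym (coeff-++ m n (map (mulTerm s) p) (r ⊗ p))) ⟩
  coeff m n (map (mulTerm t) (s ∷ r)) ℤ.+ coeff m n ((s ∷ r) ⊗ p) ∎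
  where open ≡.≡-Reasoning

⊗-comm : ∀ p r → p ⊗ r ≋ r ⊗ p
⊗-comm [] r = equal λ m n → ≡.cong (coeff m n) (≡.sym (⊗-[] r))
⊗-comm (t ∷ p) r = equal λ m n → ≡.trans (coeff-++ m n (map (mulTerm t) r) (p ⊗ r))
  (≡.trans (≡.cong (ℤ._+_ (coeff m n (map (mulTerm t) r))) (coeff-≡ (⊗-comm p r) m n))
    (≡.sym (⊗-∷ r t p m n)))

≋-trans : ∀ {p r s} → p ≋ r → r ≋ s → p ≋ s
≋-trans e e′ = equal λ m n → ≡.trans (coeff-≡ e m n) (coeff-≡ e′ m n)

coeff-∷-⊗ : ∀ d e c p r m n → coeff (d ℤ.+ m) n (((d , e , c) ∷ p) ⊗ r)
  ≡ (c • monomial e ⊛ coefficientSeries r m) n ℤ.+ coeff (d ℤ.+ m) n (p ⊗ r)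
coeff-∷-⊗ d e c p r m n = ≡.trans (coeff-++ (d ℤ.+ m) n (map (mulTerm (d , e , c)) r) (p ⊗ r))
  (≡.cong (λ i → i ℤ.+ coeff (d ℤ.+ m) n (p ⊗ r)) (coeff-map-mulTerm d e c m n r))

⊗-congˡ : ∀ p {r s} → r ≋ s → p ⊗ r ≋ p ⊗ s
⊗-congˡ [] e = equal λ m n → ≡.refl
⊗-congˡ ((d , k , c) ∷ p) {r} {s} e = equal λ m n →
  -- `coeff-∷-⊗` speaks of indices of the form d + m only, so m is written as d + (m - d).
  ≡.subst (λ m → coeff m n (((d , k , c) ∷ p) ⊗ r) ≡ coeff m n (((d , k , c) ∷ p) ⊗ s)) (shift m)
    (≡.trans (coeff-∷-⊗ d k c p r (m ℤ.- d) n) (≡.trans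
      (≡.cong₂ ℤ._+_ (⊛-cong-≤ n (λ _ _ → ≡.refl) (λ i _ → coeff-≡ e (m ℤ.- d) i))
        (coeff-≡ (⊗-congˡ p e) (d ℤ.+ (m ℤ.- d)) n))
      (≡.sym (coeff-∷-⊗ d k c p s (m ℤ.- d) n))))
  where
  shift : ∀ m → d ℤ.+ (m ℤ.- d) ≡ m
  shift m = I.solve 2 (λ d m → d I.:+ (m I.:- d) I.:= m) ≡.refl d m

⊗-commutativeSemigroup : CommutativeSemigroup 0ℓ 0ℓ
⊗-commutativeSemigroup = record
  { Carrier = Poly
  ; _≈_ = _≋_
  ; _∙_ = _⊗_
  ; isCommutativeSemigroup = record
    { isSemigroup = record
      { isMagma = record
        { isEquivalence = record
          { refl = equal λ _ _ → ≡.refl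
          ; sym = λ e → equal λ m n → ≡.sym (coeff-≡ e m n)
          ; trans = ≋-trans
          }
        ; ∙-cong = λ {p} {r} {s} {t} e e′ → ≋-trans (⊗-congˡ p e′)
            (≋-trans (⊗-comm p t) (≋-trans (⊗-congˡ t e) (⊗-comm t r)))
        }
      ; assoc = λ p r s → equal λ m n → ≡.cong (coeff m n) (⊗-assoc p r s)
      }
    ; comm = ⊗-comm
    }
  }

module ⊗ where
  open CommutativeSemigroup ⊗-commutativeSemigroup public
  open Algebra.Properties.CommutativeSemigroup ⊗-commutativeSemigroup public

-- Evaluating the truncated sums `Wtrunc` and `Ztrunc`

pow-monomial : ∀ (e : ℕ → ℕ) p k → pow p 0 ≡ mon (+ 1) (+ 0) (e 0) → p ≡ mon (+ 1) (+ 0) k →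
  (∀ j → e j ℕ.+ k ≡ e (suc j)) → ∀ j → pow p j ≡ mon (+ 1) (+ 0) (e j)
pow-monomial e p k p₀ p₁ step zero = p₀
pow-monomial e p k p₀ p₁ step (suc j) = ≡.trans
  (≡.cong₂ _⊗_ (pow-monomial e p k p₀ p₁ step j) p₁)
  (≡.cong (mon (+ 1) (+ 0)) (step j))

pow-Q : ∀ j → pow Q j ≡ mon (+ 1) (+ 0) j
pow-Q = pow-monomial (λ j → j) Q 1 ≡.refl ≡.refl (λ j → ℕ.+-comm j 1)

pow-Q² : ∀ j → pow (pow Q 2) j ≡ mon (+ 1) (+ 0) (j ℕ.+ j)
pow-Q² = pow-monomial (λ j → j ℕ.+ j) (pow Q 2) 2 ≡.refl ≡.refl
  (λ j → ≡.trans (ℕ.+-comm (j ℕ.+ j) 2) (≡.cong suc (≡.sym (ℕ.+-suc j j))))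

module Evaluation (N : ℕ) where
  open UpTo N using (pointwise; truncatedSeries)
  open TruncatedSeries truncatedSeries hiding (zero)
  open SeriesAlgebra truncatedSeries
  open Solver using (solve; _:=_; _:+_; _:*_; con)
  open import Relation.Binary.Reasoning.Setoid setoid

  infix 20 _[_]
  _[_] : Poly → ℤ → Carrier
  p [ m ] = coefficientSeries p m

  []-cong : ∀ {p r} m → p ≋ r → p [ m ] ≈ r [ m ]
  []-cong m e = pointwise (coeff-≡ e m)

  ⊕-[] : ∀ p r m → (p ⊕ r) [ m ] ≈ p [ m ] + r [ m ]
  ⊕-[] p r m = pointwise (λ n → coeff-++ m n p r)

  -- Meant for polynomials without x, which multiply every x-coefficient by one and the same series.
  -- The property passes to sums and products, hence to the denominators.
  ActsAs : Poly → Carrier → Set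
  ActsAs p s = ∀ r m → (p ⊗ r) [ m ] ≈ s * r [ m ]

  actsAs-mon : ∀ c e → ActsAs (mon c (+ 0) e) (c • monomial e)
  actsAs-mon c e r m = pointwise λ n → ≡.subst
    (λ m′ → coeff m′ n (mon c (+ 0) e ⊗ r) ≡ (c • monomial e ⊛ coefficientSeries r m) n) (ℤ.+-identityˡ m)
    (≡.trans (coeff-∷-⊗ (+ 0) e c [] r m n) (ℤ.+-identityʳ _))

  actsAs-resp : ∀ {p s t} → s ≈ t → ActsAs p s → ActsAs p t
  actsAs-resp e a r m = trans (a r m) (*-congʳ e)

  actsAs-q^ : ∀ e → ActsAs (mon (+ 1) (+ 0) e) (q^ e)
  actsAs-q^ e = actsAs-resp {mon (+ 1) (+ 0) e} (pointwise λ n → ℤ.*-identityˡ _) (actsAs-mon (+ 1) e)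

  actsAs-⊗ : ∀ {p r s t} → ActsAs p s → ActsAs r t → ActsAs (p ⊗ r) (s * t)
  actsAs-⊗ {p} {r} {s} {t} a b u m = begin
    ((p ⊗ r) ⊗ u) [ m ] ≈⟨ []-cong m (⊗.assoc p r u) ⟩
    (p ⊗ (r ⊗ u)) [ m ] ≈⟨ a (r ⊗ u) m ⟩
    s * (r ⊗ u) [ m ] ≈⟨ *-congˡ (b u m) ⟩
    s * (t * u [ m ]) ≈⟨ *-assoc s t _ ⟨
    s * t * u [ m ] ∎

  actsAs-⊕ : ∀ {p r s t} → ActsAs p s → ActsAs r t → ActsAs (p ⊕ r) (s + t)
  actsAs-⊕ {p} {r} {s} {t} a b u m = begin
    ((p ⊕ r) ⊗ u) [ m ] ≡⟨ ≡.cong (λ v → v [ m ]) (++-⊗ p r u) ⟩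
    ((p ⊗ u) ⊕ (r ⊗ u)) [ m ] ≈⟨ ⊕-[] (p ⊗ u) (r ⊗ u) m ⟩
    (p ⊗ u) [ m ] + (r ⊗ u) [ m ] ≈⟨ +-cong (a u m) (b u m) ⟩
    s * u [ m ] + t * u [ m ] ≈⟨ distribʳ _ s t ⟨
    (s + t) * u [ m ] ∎

  actsAs-one : ActsAs one 1#
  actsAs-one = actsAs-q^ 0

  actsAs-Q : ActsAs Q (q^ 1)
  actsAs-Q = actsAs-q^ 1

  actsAs-negQ : ActsAs (neg Q) (- q^ 1)
  actsAs-negQ = actsAs-resp {neg Q} (pointwise λ n → ℤ.-1*i≡-i _) (actsAs-mon -[1+ 0 ] 1)

  actsAs-pow : ∀ {p s} k → ActsAs p s → ActsAs (pow p k) (s ^ k)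
  actsAs-pow zero a = actsAs-one
  actsAs-pow {p} (suc k) a = actsAs-⊗ {pow p k} {p} (actsAs-pow k a) a

  actsAs-sumP≤ : ∀ n {f s} → (∀ i → ActsAs (f i) (s i)) → ActsAs (sumP≤ n f) (∑ n s)
  actsAs-sumP≤ zero a = a 0
  actsAs-sumP≤ (suc n) {f} a = actsAs-⊕ {sumP≤ n f} {f (suc n)} (actsAs-sumP≤ n a) (a (suc n))

  actsAs-prodP : ∀ n {f s} → (∀ i → ActsAs (f i) (s i)) → ActsAs (prodP n f) (∏ n s)
  actsAs-prodP zero a = actsAs-one
  actsAs-prodP (suc n) {f} a = actsAs-⊗ {prodP n f} {f n} (actsAs-prodP n a) (a n)

  actsAs-geom : ∀ {t s} → ActsAs t s → ActsAs (geom N t) (geometric s)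
  actsAs-geom {t} a = actsAs-sumP≤ N {f = pow t} (λ i → actsAs-pow i a)

  actsAs-qPochInv : ∀ {p s} k → ActsAs p s →
    ActsAs (qPochInv N Q p k) (∏ k (λ j → geometric (q^ 1 * s ^ j)))
  actsAs-qPochInv {p} k a = actsAs-prodP k {f = λ j → geom N (Q ⊗ pow p j)}
    (λ j → actsAs-geom {Q ⊗ pow p j} (actsAs-⊗ {Q} {pow p j} actsAs-Q (actsAs-pow j a)))

  factor-[] : ∀ d e r m → ((one ⊕ mon (+ 1) d e) ⊗ r) [ d ℤ.+ m ] ≈ r [ d ℤ.+ m ] + q^ e * r [ m ]
  factor-[] d e r m = begin
    ((one ⊕ mon (+ 1) d e) ⊗ r) [ d ℤ.+ m ]
      ≡⟨ ≡.cong (λ v → v [ d ℤ.+ m ]) (++-⊗ one (mon (+ 1) d e) r) ⟩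
    ((one ⊗ r) ⊕ (mon (+ 1) d e ⊗ r)) [ d ℤ.+ m ] ≈⟨ ⊕-[] (one ⊗ r) (mon (+ 1) d e ⊗ r) _ ⟩
    (one ⊗ r) [ d ℤ.+ m ] + (mon (+ 1) d e ⊗ r) [ d ℤ.+ m ]
      ≈⟨ +-cong (trans (actsAs-one r (d ℤ.+ m)) (*-identityˡ _))
           (trans (pointwise (λ n → ≡.trans (coeff-∷-⊗ d e (+ 1) [] r m n) (ℤ.+-identityʳ _)))
             (*-congʳ (pointwise (λ n → ℤ.*-identityˡ _)))) ⟩
    r [ d ℤ.+ m ] + q^ e * r [ m ] ∎

  -- Serves both series: the exponents are a j = j + 1 for z and a j = 2j + 1 for w.
  module _ (a : ℕ → ℕ) {f f′ : ℕ → Poly}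
    (f≡ : ∀ j → f j ≡ one ⊕ mon (+ 1) (+ 1) (a j))
    (f′≡ : ∀ j → f′ j ≡ one ⊕ mon (+ 1) -[1+ 0 ] (a j)) where
    open Coefficient a

    private
      F : ℕ → Poly
      F k = prodP k f ⊗ prodP k f′

    -- The two new factors are moved to the front and peeled off, first the one with x, then the one
    -- with x⁻¹. `factor-[]` expects a shifted index, hence the passages through `pred` and `suc`.
    F-step : ∀ k i → F (suc k) [ i ] ≈
      (1# + x k * x k) * F k [ i ] + x k * (F k [ ℤ.pred i ] + F k [ ℤ.suc i ])
    F-step k i = begin
      F (suc k) [ i ]
        ≈⟨ []-cong i (⊗.trans (⊗.interchange (prodP k f) (f k) (prodP k f′) (f′ k))
             (⊗.trans (⊗.comm (F k) (f k ⊗ f′ k)) (⊗.assoc (f k) (f′ k) (F k)))) ⟩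
      (f k ⊗ (f′ k ⊗ F k)) [ i ]
        ≡⟨ ≡.cong₂ (λ u v → (u ⊗ (v ⊗ F k)) [ i ]) (f≡ k) (f′≡ k) ⟩
      ((one ⊕ mon (+ 1) (+ 1) (a k)) ⊗ r) [ i ]
        ≡⟨ ≡.cong (λ j → ((one ⊕ mon (+ 1) (+ 1) (a k)) ⊗ r) [ j ]) (≡.sym (ℤ.suc-pred i)) ⟩
      ((one ⊕ mon (+ 1) (+ 1) (a k)) ⊗ r) [ ℤ.suc (ℤ.pred i) ]
        ≈⟨ factor-[] (+ 1) (a k) r (ℤ.pred i) ⟩
      r [ ℤ.suc (ℤ.pred i) ] + x k * r [ ℤ.pred i ]
        ≈⟨ +-cong (trans (reflexive (≡.cong (r [_]) (≡.trans (ℤ.suc-pred i) (≡.sym (ℤ.pred-suc i)))))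
                    (factor-[] -[1+ 0 ] (a k) (F k) (ℤ.suc i)))
             (*-congˡ (factor-[] -[1+ 0 ] (a k) (F k) i)) ⟩
      F k [ ℤ.pred (ℤ.suc i) ] + x k * F k [ ℤ.suc i ] + x k * (F k [ ℤ.pred i ] + x k * F k [ i ])
        ≡⟨ ≡.cong (λ j → F k [ j ] + x k * F k [ ℤ.suc i ]
                     + x k * (F k [ ℤ.pred i ] + x k * F k [ i ])) (ℤ.pred-suc i) ⟩
      F k [ i ] + x k * F k [ ℤ.suc i ] + x k * (F k [ ℤ.pred i ] + x k * F k [ i ])
        ≈⟨ solve 4 (λ x a b c → a :+ x :* b :+ x :* (c :+ x :* a)
             := (con (+ 1) :+ x :* x) :* a :+ x :* (c :+ b))
             refl (x k) (F k [ i ]) (F k [ ℤ.suc i ]) (F k [ ℤ.pred i ]) ⟩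
      (1# + x k * x k) * F k [ i ] + x k * (F k [ ℤ.pred i ] + F k [ ℤ.suc i ]) ∎
      where
      r = (one ⊕ mon (+ 1) -[1+ 0 ] (a k)) ⊗ F k

    F≈C : ∀ k i → F k [ i ] ≈ C k ℤ.∣ i ∣
    F≈C zero (+ zero) = pointwise λ { zero → ≡.refl ; (suc n) → ≡.refl }
    F≈C zero (+ suc m) = pointwise λ n → ≡.refl
    F≈C zero -[1+ m ] = pointwise λ n → ≡.refl
    F≈C (suc k) i = trans (F-step k i) (trans
      (+-cong (*-congˡ (F≈C k i)) (*-congˡ (+-cong (F≈C k (ℤ.pred i)) (F≈C k (ℤ.suc i)))))
      (reindex i))
      where
      swap : ∀ i j l → (1# + x k * x k) * C k i + x k * (C k j + C k l)
        ≈ (1# + x k * x k) * C k i + x k * (C k l + C k j)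
      swap i j l = +-congˡ {(1# + x k * x k) * C k i} (*-congˡ {x k} (+-comm (C k j) (C k l)))
      -- For negative i the absolute value exchanges the two neighbours; at i = 0 both become 1.
      reindex : ∀ i → (1# + x k * x k) * C k ℤ.∣ i ∣ + x k * (C k ℤ.∣ ℤ.pred i ∣ + C k ℤ.∣ ℤ.suc i ∣)
        ≈ C (suc k) ℤ.∣ i ∣
      reindex (+ zero) = refl
      reindex (+ suc m) = refl
      reindex -[1+ zero ] = swap 1 2 0
      reindex -[1+ suc m ] = swap (2 ℕ.+ m) (3 ℕ.+ m) (suc m)

  sumP≤-[] : ∀ n f {s} m → (∀ i → f i [ m ] ≈ s i) → sumP≤ n f [ m ] ≈ ∑ n s
  sumP≤-[] zero f m e = e 0
  sumP≤-[] (suc n) f m e = trans (⊕-[] (sumP≤ n f) (f (suc n)) m) (+-cong (sumP≤-[] n f m e) (e (suc n)))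

  term-[] : ∀ p r t {s u v} m → p [ m ] ≈ s → ActsAs r u → ActsAs t v →
    (p ⊗ r ⊗ t) [ m ] ≈ v * (u * s)
  term-[] p r t {s} {u} {v} m e a b = begin
    (p ⊗ r ⊗ t) [ m ] ≈⟨ []-cong m (⊗.comm (p ⊗ r) t) ⟩
    (t ⊗ (p ⊗ r)) [ m ] ≈⟨ b (p ⊗ r) m ⟩
    v * (p ⊗ r) [ m ] ≈⟨ *-congˡ ([]-cong m (⊗.comm p r)) ⟩
    v * (r ⊗ p) [ m ] ≈⟨ *-congˡ (a p m) ⟩
    v * (u * p [ m ]) ≈⟨ *-congˡ (*-congˡ e) ⟩
    v * (u * s) ∎

  actsAs-pow-Q : ∀ k → ActsAs (pow Q k) (q^ k)
  actsAs-pow-Q k = ≡.subst (λ p → ActsAs p (q^ k)) (≡.sym (pow-Q k)) (actsAs-q^ k)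

  open ZSeries truncatedSeries using (zSeries)
  open WSeries truncatedSeries using (wSeries)

  Ztrunc-[] : ∀ m → Ztrunc N [ m ] ≈ zSeries ℤ.∣ m ∣
  Ztrunc-[] m = sumP≤-[] N _ m λ k → term-[]
    (qPoch (neg (X ⊗ Q)) Q k ⊗ qPoch (neg (Xinv ⊗ Q)) Q k) (pow Q k)
    (qPochInv N Q Q (2 ℕ.* k ℕ.+ 1)) m
    (F≈C suc (λ j → ≡.cong (λ p → one ⊕ neg (neg (X ⊗ Q) ⊗ p)) (pow-Q j))
             (λ j → ≡.cong (λ p → one ⊕ neg (neg (Xinv ⊗ Q) ⊗ p)) (pow-Q j)) k m)
    (actsAs-pow-Q k) (actsAs-qPochInv {Q} (2 ℕ.* k ℕ.+ 1) actsAs-Q)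

  Wtrunc-[] : ∀ m → Wtrunc N [ m ] ≈ wSeries ℤ.∣ m ∣
  Wtrunc-[] m = sumP≤-[] N _ m λ k → term-[]
    (qPoch (neg (X ⊗ Q)) (pow Q 2) k ⊗ qPoch (neg (Xinv ⊗ Q)) (pow Q 2) k) (pow Q (2 ℕ.* k))
    (qPochInv N Q (neg Q) (2 ℕ.* k ℕ.+ 1)) m
    (F≈C (λ k → suc (k ℕ.+ k)) (λ j → ≡.cong (λ p → one ⊕ neg (neg (X ⊗ Q) ⊗ p)) (pow-Q² j))
             (λ j → ≡.cong (λ p → one ⊕ neg (neg (Xinv ⊗ Q) ⊗ p)) (pow-Q² j)) k m)
    (actsAs-pow-Q (2 ℕ.* k)) (actsAs-qPochInv {neg Q} (2 ℕ.* k ℕ.+ 1) actsAs-negQ)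

-- Symmetry and unimodality of even sequences

open import Data.Integer using (_+_; _<_)

module _ (f : ℕ → ℤ) where

  private
    F : ℤ → ℤ
    F m = f ℤ.∣ m ∣

  even-symmetric : Symmetric F
  even-symmetric m = ≡.cong f (≡.sym (ℤ.∣-i∣≡∣i∣ m))

  module _ (decreasing : ∀ m → f (suc m) ℤ.≤ f m) where

    antitone : ∀ {i j} → i ℕ.≤ j → f j ℤ.≤ f i
    antitone {i} {j} p with ℕ.m≤n⇒∃[o]m+o≡n p
    ... | k , ≡.refl = go k
      where
      go : ∀ k → f (i ℕ.+ k) ℤ.≤ f i
      go zero = ℤ.≤-reflexive (≡.cong f (ℕ.+-identityʳ i))
      go (suc k) = ℤ.≤-trans (ℤ.≤-reflexive (≡.cong f (ℕ.+-suc i k)))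
        (ℤ.≤-trans (decreasing (i ℕ.+ k)) (go k))

    -- The peak is 0. It lies in the support interval, because the reflection of an endpoint is
    -- again the index of a nonzero term.
    even-unimodal : ∀ B → (∀ m → B ℕ.< m → f m ≡ + 0) → Unimodal F
    even-unimodal B vanish = (B , λ m → vanish ℤ.∣ m ∣) , λ a b (fa≢0 , fb≢0 , inside) →
      + 0 , a≤0 a fa≢0 inside , 0≤b b fb≢0 inside ,
      (λ i j _ i≤j j≤0 → antitone (∣∣-antitone i≤j j≤0)) ,
      (λ i j 0≤i i≤j _ → antitone (∣∣-monotone 0≤i i≤j))
      where
      reflect : ∀ {i} → ¬ F i ≡ + 0 → ¬ F (ℤ.- i) ≡ + 0
      reflect {i} p e = p (≡.trans (even-symmetric i) e)
      a≤0 : ∀ a {b} → ¬ F a ≡ + 0 → (∀ i → ¬ F i ≡ + 0 → a ℤ.≤ i × i ℤ.≤ b) → a ℤ.≤ + 0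
      a≤0 -[1+ n ] p inside = ℤ.-≤+
      a≤0 (+ zero) p inside = ℤ.≤-refl
      a≤0 (+ suc n) p inside with () ← proj₁ (inside -[1+ n ] (reflect {+ suc n} p))
      0≤b : ∀ b {a} → ¬ F b ≡ + 0 → (∀ i → ¬ F i ≡ + 0 → a ℤ.≤ i × i ℤ.≤ b) → + 0 ℤ.≤ b
      0≤b (+ n) p inside = ℤ.+≤+ z≤n
      0≤b -[1+ n ] p inside with () ← proj₂ (inside (+ suc n) (reflect { -[1+ n ]} p))
      ∣∣-monotone : ∀ {i j} → + 0 ℤ.≤ i → i ℤ.≤ j → ℤ.∣ i ∣ ℕ.≤ ℤ.∣ j ∣
      ∣∣-monotone (ℤ.+≤+ _) (ℤ.+≤+ p) = p
      ∣∣-antitone : ∀ {i j} → i ℤ.≤ j → j ℤ.≤ + 0 → ℤ.∣ j ∣ ℕ.≤ ℤ.∣ i ∣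
      ∣∣-antitone (ℤ.-≤- p) ℤ.-≤+ = s≤s p
      ∣∣-antitone ℤ.-≤+ (ℤ.+≤+ z≤n) = z≤n
      ∣∣-antitone (ℤ.+≤+ z≤n) (ℤ.+≤+ z≤n) = z≤n

Symmetric-resp : ∀ {f g} → f ≗ g → Symmetric f → Symmetric g
Symmetric-resp e s m = ≡.trans (≡.sym (e m)) (≡.trans (s m) (e (ℤ.- m)))

Unimodal-resp : ∀ {f g} → f ≗ g → Unimodal f → Unimodal g
Unimodal-resp {f} {g} e ((B , finite) , peaks) =
  (B , λ m p → ≡.trans (≡.sym (e m)) (finite m p)) ,
  λ a b (ga , gb , inside) →
    let p , a≤p , p≤b , up , down =
          peaks a b (nonzero a ga , nonzero b gb , λ i fi → inside i (λ gi → fi (≡.trans (e i) gi)))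
    in p , a≤p , p≤b ,
       (λ i j x y z → ≡.subst₂ ℤ._≤_ (e i) (e j) (up i j x y z)) ,
       (λ i j x y z → ≡.subst₂ ℤ._≤_ (e j) (e i) (down i j x y z))
  where
  nonzero : ∀ i → ¬ g i ≡ + 0 → ¬ f i ≡ + 0
  nonzero i p q = p (≡.trans (≡.sym (e i)) q)

-- Reading off the coefficient of q^n at truncation order n

module AtDegree (n : ℕ) where
  open UpTo n using (truncatedSeries; NonNeg)
  open UpTo.NonNeg
  open UpTo._≈_ renaming (at to ≈-at)
  open SeriesAlgebra truncatedSeries using (_≽_)
  open TruncatedSeries truncatedSeries using (q^_; _-_)
  open ZSeries truncatedSeries
  open WSeries truncatedSeries
  open Evaluation n using (Ztrunc-[]; Wtrunc-[])

  ≽⇒≤ : ∀ f g → f ≽ g → g n ℤ.≤ f n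
  ≽⇒≤ f g p = ℤ.0≤i-j⇒j≤i (at p n ℕ.≤-refl)

  -- `q^ n` has coefficient 1 at degree n, so the difference there is at least 1.
  gap⇒< : ∀ f g → f - g ≽ q^ n → g n < f n
  gap⇒< f g p = ℤ.suc[i]≤j⇒i<j (ℤ.≤-trans
    (ℤ.+-monoˡ-≤ (g n) (≡.subst (ℤ._≤ f n ℤ.- g n) (monomial-diagonal n) (≽⇒≤ (f - g) (q^ n) p)))
    (ℤ.≤-reflexive (I.solve 2 (λ a b → a I.:- b I.:+ b I.:= a) ≡.refl (f n) (g n))))

  w≡ : ∀ m → wSeries ℤ.∣ m ∣ n ≡ w m n
  w≡ m = ≡.sym (≈-at (Wtrunc-[] m) n ℕ.≤-refl)

  z≡ : ∀ m → zSeries ℤ.∣ m ∣ n ≡ z m n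
  z≡ m = ≡.sym (≈-at (Ztrunc-[] m) n ℕ.≤-refl)

  w-symmetric : Symmetric (λ m → w m n)
  w-symmetric = Symmetric-resp w≡ (even-symmetric (λ m → wSeries m n))

  z-symmetric : Symmetric (λ m → z m n)
  z-symmetric = Symmetric-resp z≡ (even-symmetric (λ m → zSeries m n))

  w-unimodal : Unimodal (λ m → w m n)
  w-unimodal = Unimodal-resp w≡ (even-unimodal (λ m → wSeries m n)
    -- The support lies in |m| ≤ n, because m ≤ m² + 2m.
    (λ m → ≽⇒≤ (wSeries m) (wSeries (suc m)) (wSeries-decreasing m)) n
    (λ m n<m → ≈-at (wSeries-vanish m (ℕ.<-≤-trans n<m
      (ℕ.≤-trans (ℕ.m≤m+n m m) (ℕ.m≤n+m (m ℕ.+ m) (m ℕ.* m))))) n ℕ.≤-refl))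

  z-unimodal : Unimodal (λ m → z m n)
  z-unimodal = Unimodal-resp z≡ (even-unimodal (λ m → zSeries m n)
    (λ m → ≽⇒≤ (zSeries m) (zSeries (suc m)) (zSeries-decreasing m)) n
    (λ m n<m → ≈-at (zSeries-vanish m (ℕ.<-≤-trans n<m (ℕ.m≤m+n m (tri m)))) n ℕ.≤-refl))

  -- If n < m² + 2m the coefficient is zero, against the hypothesis. Otherwise the gap from m to m +
  -- 1 is already strict, and the next one is nonnegative.
  w-strict : ∀ m → ¬ w (+ m) n ≡ + 0 → w (+ m + + 2) n < w (+ m) n
  w-strict m w≢0 with m ℕ.* m ℕ.+ dbl m ℕ.≤? n
  ... | no p = contradiction
    (≡.trans (≡.sym (w≡ (+ m))) (≈-at (wSeries-vanish m (ℕ.≰⇒> p)) n ℕ.≤-refl)) w≢0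
  ... | yes p = ≡.subst₂ _<_
    (≡.trans (≡.cong (λ k → wSeries k n) (ℕ.+-comm 2 m)) (w≡ (+ m + + 2))) (w≡ (+ m))
    (ℤ.≤-<-trans (≽⇒≤ (wSeries (suc m)) (wSeries (2 ℕ.+ m)) (wSeries-decreasing (suc m)))
      (gap⇒< (wSeries m) (wSeries (suc m)) (wSeries-gap m p)))

  -- The same dichotomy at m + m(m+1)/2, with strictness coming directly from the gap of step two.
  z-strict : ∀ m → ¬ z (+ m) n ≡ + 0 → z (+ m + + 2) n < z (+ m) n
  z-strict m z≢0 with m ℕ.+ tri m ℕ.≤? n
  ... | no p = contradiction
    (≡.trans (≡.sym (z≡ (+ m))) (≈-at (zSeries-vanish m (ℕ.≰⇒> p)) n ℕ.≤-refl)) z≢0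
  ... | yes p = ≡.subst₂ _<_
    (≡.trans (≡.cong (λ k → zSeries k n) (ℕ.+-comm 2 m)) (z≡ (+ m + + 2))) (z≡ (+ m))
    (gap⇒< (zSeries m) (zSeries (2 ℕ.+ m)) (zSeries-gap m p))

theorem4p11 : (∀ (n : ℕ) → Symmetric (λ m → w m n) × Unimodal (λ m → w m n)
    × Symmetric (λ m → z m n) × Unimodal (λ m → z m n))
    × (∀ (m n : ℕ) → (¬ (w (+ m) n ≡ + 0) → w (+ m + + 2) n < w (+ m) n)
    × (¬ (z (+ m) n ≡ + 0) → z (+ m + + 2) n < z (+ m) n))
theorem4p11 =
  (λ n → let open AtDegree n in w-symmetric , w-unimodal , z-symmetric , z-unimodal) ,
  (λ m n → let open AtDegree n in w-strict m , z-strict m)
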